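{- Let $b_n$ ($n\ge 1$), $c_n$ ($n\ge 0$) and $\kappa$ be arbitrary nonzero constants, let $f_k$ ($k\in\mathbb{Z}$) be the moments, normalized by $f_1=\kappa$, of the Laurent biorthogonal polynomials with recurrence coefficients $b_n,c_n$, and let $\tilde\kappa=\kappa/c_0$, $\tilde b_n=b_n/(c_{n-1}c_n)$, $\tilde c_n=1/c_n$. For $s\in\mathbb{Z}$ and $n\in\mathbb{N}$, the moment determinant $\Delta^{(s)}_n=\det(f_{s-j+k})_{j,k=0,\ldots,n-1}$ satisfies $$\Delta^{(s)}_{n} = (-1)^{\frac{n(n-1)}{2}} \kappa^{n} \left( \prod_{j=1}^{n-1} b_j^{n-j} \right) \sum_{\boldsymbol{P} \in \boldsymbol{S}_{s-n,n}} w(\boldsymbol{P}) \qquad \text{if } s \ge n,$$ $$\Delta^{(s)}_{n} = (-1)^{\frac{n(n-1)}{2}} \tilde{\kappa}^{n} \left( \prod_{j=1}^{n-1} \tilde{b}_j^{n-j} \right) \sum_{\boldsymbol{P} \in \boldsymbol{S}_{|s|-n+1,n}} \tilde{w}(\boldsymbol{P}) \qquad \text{if } s \le -n+1.$$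
   Context: $\mathbb{N}=\{0,1,2,\ldots\}$; empty products and $0\times0$ determinants equal $1$. Laurent biorthogonal polynomials: $P_0(z)=1$, $P_1(z)=z-c_0$, $P_{n+1}(z)=(z-c_n)P_n(z)-b_n zP_{n-1}(z)$ for $n\ge1$. There is a linear functional $\mathcal{F}$ on Laurent polynomials in $z$, unique up to a constant factor, with $\mathcal{F}[P_n(z)z^{ -k}]=h_n\delta_{n,k}$ for $0\le k\le n$ and some constants $h_n\neq0$. It is fixed by $\mathcal{F}[z]=\kappa$, and the moments are $f_k=\mathcal{F}[z^k]$, $k\in\mathbb{Z}$. A Schröder path is a lattice path in $\mathbb{Z}^2$ consisting of up steps $(1,1)$, down steps $(1,-1)$ and level steps $(2,0)$, never going beneath the $x$-axis (a path consisting of a single point is allowed). The weight $w(P)$ of a Schröder path $P$ is the product of the labels of its steps, where an up step is labelled $1$, a down step descending from the line $y=n$ (to $y=n-1$) is labelled $b_n$, and a level step on the line $y=n$ is labelled $c_n$. The weight $\tilde w(P)$ is defined in the same way with $\tilde b_n,\tilde c_n$ in place of $b_n,c_n$. For $m,n\in\mathbb{N}$, $\boldsymbol{S}_{m,n}$ is the set of $n$-tuples $\boldsymbol{P}=(P_0,\ldots,P_{n-1})$ of Schröder paths such that $P_k$ goes from $(-k,k)$ to $(2m+k,k)$ for each $k$, and any two distinct paths are non-intersecting, i.e. $P_j\cap P_k=\emptyset$ for $j\ne k$. Set $w(\boldsymbol{P})=\prod_{k=0}^{n-1}w(P_k)$ and $\tilde w(\boldsymbol{P})=\prod_{k=0}^{n-1}\tilde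 w(P_k)$. -}

module Defs where

open import Level using (Level; _⊔_)
open import Function.Base using (_∘_)
open import Function.Bundles using (_⇔_; mk⇔)
open import Data.Bool.Base using (if_then_else_)
open import Data.Nat.Base as ℕ using (ℕ; zero; suc; pred; _∸_)
import Data.Nat.Properties as ℕ
open import Data.Integer.Base as ℤ using (ℤ; +_; 0ℤ; 1ℤ; ∣_∣)
import Data.Integer.Properties as ℤ
open import Data.Integer.Tactic.RingSolver using (solve-∀)
open import Data.Fin.Base using (Fin; zero; suc; toℕ; punchIn)
import Data.Fin.Properties as Fin
open import Data.Product.Base using (_×_; _,_; proj₁; proj₂)
open import Data.Product.Properties using (≡-dec)
open import Data.List.Base as List using (List; []; _∷_; _++_; cartesianProductWith; filter)
import Data.List.Properties as List
open import Data.List.Relation.Unary.All as All using (All)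
open import Data.List.Relation.Unary.Any using (here; there)
open import Data.List.Membership.Propositional using (_∈_)
open import Data.List.Membership.Propositional.Properties
  using (∈-map⁺; ∈-map⁻; ∈-++⁺ˡ; ∈-++⁺ʳ; ∈-++⁻; ∈-filter⁺; ∈-filter⁻; ∈-cartesianProductWith⁺)
open import Data.List.Relation.Binary.Disjoint.Propositional using (Disjoint)
open import Data.List.Relation.Unary.Unique.Propositional using (Unique; []; _∷_)
import Data.List.Relation.Unary.Unique.Propositional.Properties as Unique
open import Data.Sum.Base using (inj₁; inj₂)
open import Data.Vec.Base as Vec using (Vec; []; _∷_; lookup)
import Data.Vec.Properties as Vec
open import Relation.Nullary.Decidable using (Dec; does; map′; ¬?; _×-dec_; _→-dec_)
open import Relation.Unary using (Decidable)
open import Relation.Binary.Definitions using (DecidableEquality)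
open import Relation.Binary.PropositionalEquality as ≡ using (_≡_; _≢_; refl; cong)

open import Algebra.Bundles using (Semiring; CommutativeRing)
open import Algebra.Apartness.Bundles using (HeytingCommutativeRing; HeytingField)
open import Algebra.Module.Bundles.Raw using (RawLeftModule)
import Algebra.Module.Construct.TensorUnit as TensorUnit
import Algebra.Module.Morphism.Structures as ModuleMorphism
import Algebra.Definitions.RawMonoid as RawMonoidDefs
import Algebra.Definitions.RawSemiring as RawSemiringDefs
import Algebra.Apartness.Properties.HeytingCommutativeRing as HeytingProperties

Point : Set
Point = ℤ × ℤ

data Step : Set where
  up down level : Step

move : Step → Point → Point
move up    (x , y) = (x ℤ.+ 1ℤ  , y ℤ.+ 1ℤ)
move down  (x , y) = (x ℤ.+ 1ℤ  , y ℤ.- 1ℤ)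
move level (x , y) = (x ℤ.+ + 2 , y)

record Path : Set where
  constructor path
  field
    start : Point
    steps : List Step

open Path public

-- The midpoint of a level step is not a vertex.
verticesFrom : Point → List Step → List Point
verticesFrom p []       = p ∷ []
verticesFrom p (t ∷ ts) = p ∷ verticesFrom (move t p) ts

endFrom : Point → List Step → Point
endFrom p []       = p
endFrom p (t ∷ ts) = endFrom (move t p) ts

vertices : Path → List Point
vertices P = verticesFrom (start P) (steps P)

end : Path → Point
end P = endFrom (start P) (steps P)

IsSchröder : Path → Set
IsSchröder P = All (λ p → 0ℤ ℤ.≤ proj₂ p) (vertices P)

-- All end points in S m n have even coordinate sum, a parity that every step
-- preserves, so two such paths that meet anywhere in the plane share a vertex.
NonIntersecting : Path → Path → Set
NonIntersecting P Q = Disjoint (vertices P) (vertices Q)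

record S (m n : ℕ) (𝐏 : Vec Path n) : Set where
  constructor mkS
  field
    schröder        : ∀ k → IsSchröder (lookup 𝐏 k)
    starts          : ∀ k → start (lookup 𝐏 k) ≡ (ℤ.- + toℕ k , + toℕ k)
    ends            : ∀ k → end (lookup 𝐏 k) ≡ (+ (2 ℕ.* m ℕ.+ toℕ k) , + toℕ k)
    nonIntersecting : ∀ j k → j ≢ k → NonIntersecting (lookup 𝐏 j) (lookup 𝐏 k)

_≟P_ : DecidableEquality Point
_≟P_ = ≡-dec ℤ._≟_ ℤ._≟_

open import Data.List.Membership.DecPropositional _≟P_ using (_∈?_)

nonIntersecting? : ∀ P Q → Dec (NonIntersecting P Q)
nonIntersecting? P Q = map′
  (λ { a (p∈P , p∈Q) → All.lookup a p∈P p∈Q })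
  (λ d → All.tabulate λ p∈P p∈Q → d (p∈P , p∈Q))
  (All.all? (λ p → ¬? (p ∈? vertices Q)) (vertices P))

S? : ∀ m n → Decidable (S m n)
S? m n 𝐏 = map′
  (λ (a , b , c , d) → mkS a b c d)
  (λ s → S.schröder s , S.starts s , S.ends s , S.nonIntersecting s)
  (Fin.all? (λ k → All.all? (λ p → 0ℤ ℤ.≤? proj₂ p) (vertices (lookup 𝐏 k)))
   ×-dec Fin.all? (λ k → start (lookup 𝐏 k) ≟P _)
   ×-dec Fin.all? (λ k → end (lookup 𝐏 k) ≟P _)
   ×-dec Fin.all? (λ j → Fin.all? (λ k →
           ¬? (j Fin.≟ k) →-dec nonIntersecting? (lookup 𝐏 j) (lookup 𝐏 k))))

width : List Step → ℕ
width []           = 0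
width (up    ∷ ts) = 1 ℕ.+ width ts
width (down  ∷ ts) = 1 ℕ.+ width ts
width (level ∷ ts) = 2 ℕ.+ width ts

wordsOfWidth : ℕ → List (List Step)
wordsOfWidth 0             = [] ∷ []
wordsOfWidth 1             = (up ∷ []) ∷ (down ∷ []) ∷ []
wordsOfWidth (suc (suc l)) =
  List.map (up ∷_) (wordsOfWidth (suc l)) ++
  List.map (down ∷_) (wordsOfWidth (suc l)) ++
  List.map (level ∷_) (wordsOfWidth l)

choices : ∀ {A : Set} {n} → (Fin n → List A) → List (Vec A n)
choices {n = zero}  L = [] ∷ []
choices {n = suc n} L = cartesianProductWith _∷_ (L zero) (choices (L ∘ suc))

S-list : (m n : ℕ) → List (Vec Path n)
S-list m n = filter (S? m n) (choices λ k →
  List.map (path (ℤ.- + toℕ k , + toℕ k)) (wordsOfWidth (2 ℕ.* m ℕ.+ toℕ k ℕ.+ toℕ k)))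

private
  ∈-words : ∀ ts → ts ∈ wordsOfWidth (width ts)
  ∈-words [] = here refl
  ∈-words (up ∷ ts) with width ts | ∈-words ts
  ... | 0     | here refl = here refl
  ... | suc l | ts∈       = ∈-++⁺ˡ (∈-map⁺ (up ∷_) ts∈)
  ∈-words (down ∷ ts) with width ts | ∈-words ts
  ... | 0     | here refl = there (here refl)
  ... | suc l | ts∈       =
    ∈-++⁺ʳ (List.map (up ∷_) (wordsOfWidth (suc l))) (∈-++⁺ˡ (∈-map⁺ (down ∷_) ts∈))
  ∈-words (level ∷ ts) =
    ∈-++⁺ʳ (List.map (up ∷_) (wordsOfWidth (suc (width ts))))
      (∈-++⁺ʳ (List.map (down ∷_) (wordsOfWidth (suc (width ts))))
        (∈-map⁺ (level ∷_) (∈-words ts)))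

  end-width : ∀ p ts → proj₁ (endFrom p ts) ≡ proj₁ p ℤ.+ + width ts
  end-width p [] = ≡.sym (ℤ.+-identityʳ _)
  end-width p (up    ∷ ts) = ≡.trans (end-width _ ts) (ℤ.+-assoc (proj₁ p) 1ℤ (+ width ts))
  end-width p (down  ∷ ts) = ≡.trans (end-width _ ts) (ℤ.+-assoc (proj₁ p) 1ℤ (+ width ts))
  end-width p (level ∷ ts) = ≡.trans (end-width _ ts) (ℤ.+-assoc (proj₁ p) (+ 2) (+ width ts))

  ∈-choices : ∀ {A : Set} {n} (L : Fin n → List A) (v : Vec A n) →
              (∀ k → lookup v k ∈ L k) → v ∈ choices L
  ∈-choices L []      h = here refl
  ∈-choices L (x ∷ v) h =
    ∈-cartesianProductWith⁺ _∷_ (h zero) (∈-choices (L ∘ suc) v (h ∘ suc))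

  ∷-disjoint : ∀ {s t : Step} {us vs} → s ≢ t →
               Disjoint (List.map (s ∷_) us) (List.map (t ∷_) vs)
  ∷-disjoint s≢t (v∈ , v∈′) with _ , _ , refl ← ∈-map⁻ _ v∈ | _ , _ , eq ← ∈-map⁻ _ v∈′ =
    s≢t (List.∷-injectiveˡ eq)

  words-unique : ∀ l → Unique (wordsOfWidth l)
  words-unique 0 = All.[] ∷ []
  words-unique 1 = ((λ ()) All.∷ All.[]) ∷ All.[] ∷ []
  words-unique (suc (suc l)) =
    Unique.++⁺ (∷-unique (words-unique (suc l)))
      (Unique.++⁺ (∷-unique (words-unique (suc l))) (∷-unique (words-unique l))
        (∷-disjoint λ ()))
      up-disjoint
    where
    ∷-unique : ∀ {s : Step} {us} → Unique us → Unique (List.map (s ∷_) us)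
    ∷-unique = Unique.map⁺ List.∷-injectiveʳ
    up-disjoint : Disjoint (List.map (up ∷_) (wordsOfWidth (suc l)))
                    (List.map (down ∷_) (wordsOfWidth (suc l)) ++
                     List.map (level ∷_) (wordsOfWidth l))
    up-disjoint (v∈ , v∈′) with ∈-++⁻ (List.map (down ∷_) (wordsOfWidth (suc l))) v∈′
    ... | inj₁ v∈d = ∷-disjoint (λ ()) (v∈ , v∈d)
    ... | inj₂ v∈l = ∷-disjoint (λ ()) (v∈ , v∈l)

  choices-unique : ∀ {A : Set} {n} (L : Fin n → List A) →
                   (∀ k → Unique (L k)) → Unique (choices L)
  choices-unique {n = zero}  L u = All.[] ∷ []
  choices-unique {n = suc n} L u =
    Unique.cartesianProductWith⁺ _∷_ Vec.∷-injective (u zero)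
      (choices-unique (L ∘ suc) (u ∘ suc))

∈-S-list : ∀ {m n} {𝐏 : Vec Path n} → 𝐏 ∈ S-list m n ⇔ S m n 𝐏
∈-S-list {m} {n} {𝐏} = mk⇔
  (λ 𝐏∈ → proj₂ (∈-filter⁻ (S? m n) {xs = choices _} 𝐏∈))
  (λ s → ∈-filter⁺ (S? m n) (∈-choices _ 𝐏 (λ k → candidate k (S.starts s k) (S.ends s k))) s)
  where
  solve-width : ∀ (k e w : ℤ) → e ≡ ℤ.- k ℤ.+ w → w ≡ e ℤ.+ k
  solve-width k e w eq = ≡.trans (shuffle k w) (cong (ℤ._+ k) (≡.sym eq))
    where
    shuffle : ∀ k w → w ≡ ℤ.- k ℤ.+ w ℤ.+ k
    shuffle = solve-∀
  candidate : ∀ {P} (k : Fin n) → start P ≡ (ℤ.- + toℕ k , + toℕ k) →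
              end P ≡ (+ (2 ℕ.* m ℕ.+ toℕ k) , + toℕ k) →
              P ∈ List.map (path (ℤ.- + toℕ k , + toℕ k))
                    (wordsOfWidth (2 ℕ.* m ℕ.+ toℕ k ℕ.+ toℕ k))
  candidate {path _ ts} k refl e = ∈-map⁺ _ (≡.subst (λ l → ts ∈ wordsOfWidth l)
    (ℤ.+-injective (solve-width (+ toℕ k) _ (+ width ts)
      (≡.trans (≡.sym (cong proj₁ e)) (end-width _ ts))))
    (∈-words ts))

S-list-unique : ∀ m n → Unique (S-list m n)
S-list-unique m n = Unique.filter⁺ (S? m n) (choices-unique _
  (λ k → Unique.map⁺ (cong steps) (words-unique (2 ℕ.* m ℕ.+ toℕ k ℕ.+ toℕ k))))

module Over {a ℓ₁ ℓ₂ : Level} (K : HeytingField a ℓ₁ ℓ₂) where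

  open HeytingField K hiding (refl; zero)
  open HeytingProperties heytingCommutativeRing using (x#0y#0→xy#0; x-0≈x)

  K-commutativeRing : CommutativeRing a ℓ₁
  K-commutativeRing = HeytingCommutativeRing.commutativeRing heytingCommutativeRing

  open CommutativeRing K-commutativeRing using (semiring; rawRing; +-rawMonoid; *-rawMonoid)
  open Semiring semiring using (rawSemiring)
  open RawSemiringDefs rawSemiring public using (_^_)
  open RawMonoidDefs +-rawMonoid public using (sum)
  open RawMonoidDefs *-rawMonoid public using () renaming (sum to product)

  inv : ∀ x → x # 0# → Carrier
  inv x x#0 = proj₁ (#⇒invertible x#0)

  inv-inverseˡ : ∀ x (x#0 : x # 0#) → inv x x#0 * x ≈ 1#
  inv-inverseˡ x x#0 =
    trans (*-congˡ (sym (x-0≈x x))) (proj₁ (proj₂ (#⇒invertible x#0)))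

  det : ∀ {n} → (Fin n → Fin n → Carrier) → Carrier
  det {zero}  A = 1#
  det {suc n} A = sum λ k →
    (- 1#) ^ toℕ k * A zero k * det (λ i j → A (suc i) (punchIn k j))

  -- Laurent polynomials: finite formal sums of terms (coefficient , exponent),
  -- compared coefficientwise
  Laurent : Set a
  Laurent = List (Carrier × ℤ)

  coeff : Laurent → ℤ → Carrier
  coeff []            k = 0#
  coeff ((x , e) ∷ p) k = (if does (e ℤ.≟ k) then x else 0#) + coeff p k

  infix  4 _≈ᴸ_
  infixl 6 _-ᴸ_
  infixl 7 _*ᴸ_
  infixr 8 _·ᴸ_

  _≈ᴸ_ : Laurent → Laurent → Set ℓ₁
  p ≈ᴸ q = ∀ k → coeff p k ≈ coeff q k

  _·ᴸ_ : Carrier → Laurent → Laurent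
  x ·ᴸ p = List.map (λ (y , e) → x * y , e) p

  -ᴸ_ : Laurent → Laurent
  -ᴸ p = List.map (λ (y , e) → - y , e) p

  _-ᴸ_ : Laurent → Laurent → Laurent
  p -ᴸ q = p ++ (-ᴸ q)

  _*ᴸ_ : Laurent → Laurent → Laurent
  _*ᴸ_ = cartesianProductWith (λ (x , d) (y , e) → x * y , d ℤ.+ e)

  const : Carrier → Laurent
  const x = (x , 0ℤ) ∷ []

  z^_ : ℤ → Laurent
  z^ k = (1# , k) ∷ []

  z : Laurent
  z = z^ 1ℤ

  laurentRawLeftModule : RawLeftModule Carrier a ℓ₁
  laurentRawLeftModule = record
    { Carrierᴹ = Laurent
    ; _≈ᴹ_     = _≈ᴸ_
    ; _+ᴹ_     = _++_
    ; _*ₗ_     = _·ᴸ_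
    ; 0ᴹ       = []
    ; -ᴹ_      = -ᴸ_
    }

  IsLinearFunctional : (Laurent → Carrier) → Set (a ⊔ ℓ₁)
  IsLinearFunctional = ModuleMorphism.LeftModuleMorphisms.IsLeftModuleHomomorphism
    laurentRawLeftModule (TensorUnit.rawLeftModule {R = rawRing})

  -- The value b 0 is never used.
  LBP : (b c : ℕ → Carrier) → ℕ → Laurent
  LBP b c 0             = const 1#
  LBP b c 1             = z -ᴸ const (c 0)
  LBP b c (suc (suc n)) =
    (z -ᴸ const (c (suc n))) *ᴸ LBP b c (suc n) -ᴸ b (suc n) ·ᴸ z *ᴸ LBP b c n

  δ : ℕ → ℕ → Carrier
  δ n k = if does (n ℕ.≟ k) then 1# else 0#

  record MomentFunctional (b c : ℕ → Carrier) (κ : Carrier) : Set (a ⊔ ℓ₁ ⊔ ℓ₂) where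
    field
      𝓕          : Laurent → Carrier
      linear     : IsLinearFunctional 𝓕
      h          : ℕ → Carrier
      h#0        : ∀ n → h n # 0#
      orthogonal : ∀ n k → k ℕ.≤ n → 𝓕 (LBP b c n *ᴸ z^ (ℤ.- + k)) ≈ h n * δ n k
      normalized : 𝓕 z ≈ κ

    f : ℤ → Carrier
    f k = 𝓕 (z^ k)

  Δ : (ℤ → Carrier) → ℤ → ℕ → Carrier
  Δ f s n = det {n} λ j k → f (s ℤ.- + toℕ j ℤ.+ + toℕ k)

  -- Heights are non-negative on Schröder paths, so ∣ y ∣ is y there.
  label : (b c : ℕ → Carrier) → Step → Point → Carrier
  label b c up    (x , y) = 1#
  label b c down  (x , y) = b ∣ y ∣
  label b c level (x , y) = c ∣ y ∣

  weightFrom : (b c : ℕ → Carrier) → Point → List Step → Carrier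
  weightFrom b c p []       = 1#
  weightFrom b c p (t ∷ ts) = label b c t p * weightFrom b c (move t p) ts

  weight : (b c : ℕ → Carrier) → Path → Carrier
  weight b c P = weightFrom b c (start P) (steps P)

  tupleWeight : (b c : ℕ → Carrier) → ∀ {n} → Vec Path n → Carrier
  tupleWeight b c 𝐏 = product λ k → weight b c (lookup 𝐏 k)

  ∑S : (m n : ℕ) → (Vec Path n → Carrier) → Carrier
  ∑S m n g = List.foldr _+_ 0# (List.map g (S-list m n))

  -- The index i stands for j = i + 1, with 1 ≤ j ≤ n - 1.
  ∏b^ : (b : ℕ → Carrier) → ℕ → Carrier
  ∏b^ b n = product {n ∸ 1} λ i → b (suc (toℕ i)) ^ (n ∸ suc (toℕ i))

  module Tilde (b c : ℕ → Carrier) (c#0 : ∀ n → c n # 0#) (κ : Carrier) where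

    κ̃ : Carrier
    κ̃ = κ * inv (c 0) (c#0 0)

    -- Only meaningful for n ≥ 1.
    b̃ : ℕ → Carrier
    b̃ n = b n * inv (c (pred n) * c n) (x#0y#0→xy#0 (c#0 (pred n)) (c#0 n))

    c̃ : ℕ → Carrier
    c̃ n = inv (c n) (c#0 n)

{-# OPTIONS --safe #-}

-- In terms of the recurrence coefficients the moments are f_{s+1} = κ g(s) and
-- f_{-s} = κ̃ g̃(s), where g(s) is the total weight of the Schröder paths from
-- (0,0) to (2s,0): the three-term recurrence applied to 𝓕[P_n z^e] decomposes a
-- path by its first step, and orthogonality gives the boundary values. Both
-- determinants thus become Hankel determinants of path counts. Modulo the
-- columns with smaller index, the column of the point (-2k,0) equals the column
-- of (-k,k), so the starting points may be moved to those of the tuples in S.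
--
-- The Lindström-Gessel-Viennot identity is proved without an involution. Let D(a)
-- be the determinant of path counts and N(a) the weighted number of admissible
-- tuples, as functions of the starting points a. Expanding the first step of the
-- path whose starting point no other path can reach gives the same recursion for
-- D and N; both vanish when two starting points coincide; and when every
-- starting point lies on the line x - y = 2m of the end points, D is triangular.
-- Planarity is carried along as the monotonicity of the coordinates x + y and
-- x - y of the starting points.

module Submission where

open import Defs
open import Level using (_⊔_)
open import Function.Base using (_∘_; const)
open import Algebra.Bundles using (CommutativeRing)
open import Algebra.Apartness.Bundles using (HeytingField)
import Algebra.Module.Morphism.Structures as ModuleMorphism
open import Data.Bool.Base using (if_then_else_)
open import Data.Nat.Base as ℕ using (ℕ; zero; suc; s≤s; z≤n; _∸_)
import Data.Nat.Properties as ℕ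
import Data.Nat.DivMod as ℕ
import Data.Nat.Divisibility as ℕ
import Data.Nat.Solver as ℕ-Solver
open import Data.Integer.Base as ℤ using (ℤ; +_; -[1+_]; 0ℤ; 1ℤ; ∣_∣)
import Data.Integer.Properties as ℤ
open import Data.Integer.Tactic.RingSolver using (solve-∀)
open import Data.Fin.Base as Fin using (Fin; zero; suc; toℕ; inject₁; fromℕ; fromℕ<; punchIn; punchOut; opposite)
import Data.Fin.Properties as Fin
import Data.Fin.Permutation as Perm
open import Data.List.Base as List using (List; []; _∷_; _++_; cartesianProductWith; filter)
import Data.List.Properties as List
open import Data.List.Membership.Propositional using (_∈_; _∉_)
open import Data.List.Membership.Propositional.Properties using (∈-map⁻; ∈-cartesianProductWith⁻)
open import Data.List.Relation.Unary.Any using (here; there)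
open import Data.List.Relation.Unary.All as All using (All; []; _∷_)
open import Data.Product.Base using (_×_; _,_; proj₁; proj₂; ∃)
open import Data.Product.Properties using (≡-dec)
open import Data.Sum.Base using (_⊎_; inj₁; inj₂)
open import Data.Vec.Base as Vec using (Vec; []; _∷_; lookup; _[_]≔_)
import Data.Vec.Properties as Vec
open import Data.Vec.Functional using (updateAt)
open import Data.Vec.Functional.Properties using (updateAt-updates; updateAt-minimal)
open import Relation.Nullary.Decidable using (Dec; yes; no; does; map′; ¬?; _×-dec_; _→-dec_; dec-false)
open import Relation.Nullary.Negation using (contradiction; ¬_)
open import Relation.Unary using (Pred; Decidable)
open import Relation.Binary.Definitions using (tri<; tri≈; tri>)
open import Relation.Binary.PropositionalEquality as ≡ using (_≡_; _≢_)

-- Finite types and natural numbers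

-- The usual involution swaps tails of paths and so ranges over families matched to the end points
-- by arbitrary permutations, whereas `N` only knows the identity matching. Since the expanded path
-- leaves a point that no other path can reach, deleting this point never hides an intersection.
-- Every intersection comes to light as a coincidence of two starting points, where two arguments of
-- the determinant agree as well.
--
-- The determinant counts paths to (2m+2j,0), but the tuples end at (2m+j,j). The end points are
-- never moved: the discrepancy shows in the terminal case, whose diagonal entries are b_1 ... b_j,
-- the weight of the descent from the one point to the other. This is the origin of the product of
-- the powers of the b_j.
--
-- Reversing the rows if s >= n, or the columns if s <= 1-n, makes the matrix a Hankel matrix in the
-- argument of g, and the reversal accounts for the sign. `AlternatingForm` collects what the
-- argument uses of either determinant, so that one proof serves both cases.

punchIn-adjacent : ∀ {n} (i : Fin n) (j : Fin n) →
  punchIn (inject₁ i) j ≡ punchIn (suc i) j ⊎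
  punchIn (inject₁ i) j ≡ suc i × punchIn (suc i) j ≡ inject₁ i
punchIn-adjacent zero    zero    = inj₂ (≡.refl , ≡.refl)
punchIn-adjacent zero    (suc j) = inj₁ ≡.refl
punchIn-adjacent (suc i) zero    = inj₁ ≡.refl
punchIn-adjacent (suc i) (suc j) with punchIn-adjacent i j
... | inj₁ eq      = inj₁ (≡.cong suc eq)
... | inj₂ (p , q) = inj₂ (≡.cong suc p , ≡.cong suc q)

-- Two adjacent columns that are both kept stay adjacent in the minor. Together with
-- `punchIn-adjacent`, for the case that one of them is deleted, this supports the induction in
-- `det-equal-adjacent`.
punchIn-avoid : ∀ {n} (l : Fin (suc (suc n))) (i : Fin (suc n)) → l ≢ inject₁ i → l ≢ suc i →
  ∃ λ (i′ : Fin n) → punchIn l (inject₁ i′) ≡ inject₁ i × punchIn l (suc i′) ≡ suc i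
punchIn-avoid zero zero p q = contradiction ≡.refl p
punchIn-avoid {suc n} zero (suc i) p q = i , ≡.refl , ≡.refl
punchIn-avoid (suc zero) zero p q = contradiction ≡.refl q
punchIn-avoid {suc n} (suc (suc l)) zero p q = zero , ≡.refl , ≡.refl
punchIn-avoid {suc n} (suc l) (suc i) p q
  with i′ , e₁ , e₂ ← punchIn-avoid l i (p ∘ ≡.cong suc) (q ∘ ≡.cong suc)
  = suc i′ , ≡.cong suc e₁ , ≡.cong suc e₂

inject₁≢suc : ∀ {n} (k : Fin n) → inject₁ k ≢ suc k
inject₁≢suc (suc k) eq = inject₁≢suc k (Fin.suc-injective eq)

punchIn-last : ∀ {n} (j : Fin n) → punchIn (fromℕ n) j ≡ inject₁ j
punchIn-last zero    = ≡.refl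
punchIn-last (suc j) = ≡.cong suc (punchIn-last j)

opposite-cong-≢ : ∀ {n} {i k : Fin n} → i ≢ opposite k → opposite i ≢ k
opposite-cong-≢ i≢ eq = i≢ (≡.trans (≡.sym (Fin.opposite-involutive _)) (≡.cong opposite eq))

n≤i+j⇒opposite-i<j : ∀ {n} (i j : Fin n) → n ℕ.≤ toℕ i ℕ.+ toℕ j → toℕ (opposite i) ℕ.< toℕ j
n≤i+j⇒opposite-i<j {n} i j n≤ = ℕ.+-cancelˡ-≤ (toℕ i) _ _ (≡.subst (ℕ._≤ toℕ i ℕ.+ toℕ j) (≡.sym eq) n≤)
  where
  eq : toℕ i ℕ.+ suc (toℕ (opposite i)) ≡ n
  eq = ≡.trans (ℕ.+-suc _ _) (≡.trans (≡.cong (suc (toℕ i) ℕ.+_) (Fin.opposite-prop i)) (ℕ.m+[n∸m]≡n (Fin.toℕ<n i)))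

1+i+j<n⇒i<opposite-j : ∀ {n} (i j : Fin n) → suc (toℕ i ℕ.+ toℕ j) ℕ.< n → toℕ i ℕ.< toℕ (opposite j)
1+i+j<n⇒i<opposite-j {n} i j <n = ≡.subst (toℕ i ℕ.<_) (≡.sym (Fin.opposite-prop j))
  (ℕ.m+n≤o⇒m≤o∸n (suc (toℕ i)) (≡.subst (ℕ._≤ n) (≡.sym (≡.cong suc (ℕ.+-suc (toℕ i) (toℕ j)))) <n))

opposite-sum : ∀ {n} (i : Fin n) → + n ≡ + toℕ (opposite i) ℤ.+ (1ℤ ℤ.+ + toℕ i)
opposite-sum {n} i = ≡.cong +_ (≡.sym (≡.trans (≡.cong (ℕ._+ suc (toℕ i)) (Fin.opposite-prop i)) (ℕ.m∸n+n≡m (Fin.toℕ<n i))))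

least : ∀ {n} {P : Fin n → Set} → Decidable P → ∃ P → ∃ λ k → P k × (∀ i → toℕ i ℕ.< toℕ k → ¬ P i)
least {suc n} P? (k , Pk) with P? zero
... | yes P0 = zero , P0 , λ _ ()
least {suc n} P? (zero  , P0) | no ¬P0 = contradiction P0 ¬P0
least {suc n} P? (suc k , Pk) | no ¬P0 with j , Pj , minimal ← least (P? ∘ suc) (k , Pk) =
  suc j , Pj , λ { zero _ → ¬P0 ; (suc i) (s≤s i<j) → minimal i i<j }

total : ∀ {A : Set} {n} → (A → ℕ) → (Fin n → A) → ℕ
total {n = zero}  F v = 0
total {n = suc n} F v = F (v zero) ℕ.+ total F (v ∘ suc)

total-updateAt-< : ∀ {A : Set} {n} (F : A → ℕ) (v : Fin n → A) k x → F x ℕ.< F (v k) →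
                   total F (updateAt v k (const x)) ℕ.< total F v
total-updateAt-< F v zero    x <F = ℕ.+-monoˡ-< _ <F
total-updateAt-< F v (suc k) x <F = ℕ.+-monoʳ-< (F (v zero)) (total-updateAt-< F (v ∘ suc) k x <F)

increasing-bound : ∀ {n} m (f : Fin n → ℕ) → (∀ k → m ℕ.≤ f k) →
                   (∀ i j → toℕ i ℕ.< toℕ j → f i ℕ.< f j) → ∀ k → m ℕ.+ toℕ k ℕ.≤ f k
increasing-bound m f m≤f mono zero    = ≡.subst (ℕ._≤ f zero) (≡.sym (ℕ.+-identityʳ m)) (m≤f zero)
increasing-bound m f m≤f mono (suc k) = ≡.subst (ℕ._≤ f (suc k)) (≡.sym (ℕ.+-suc m (toℕ k)))
  (increasing-bound (suc m) (f ∘ suc) (λ i → ℕ.≤-<-trans (m≤f zero) (mono zero (suc i) (s≤s z≤n)))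
    (λ i j i<j → mono (suc i) (suc j) (s≤s i<j)) k)

∣-∣-offset : ∀ {n s} → + n ℤ.≤ s → s ≡ + ∣ s ℤ.- + n ∣ ℤ.+ + n
∣-∣-offset {n} {s} n≤s = ≡.trans (eq s (+ n)) (≡.cong (ℤ._+ + n) (≡.sym (ℤ.0≤i⇒+∣i∣≡i (ℤ.i≤j⇒0≤j-i n≤s))))
  where
  eq : ∀ s n → s ≡ s ℤ.- n ℤ.+ n
  eq = solve-∀

-- For `n = 0` the bound admits `s = 1`, where the equation is false. An element of `Fin n` excludes
-- this, and one is at hand whenever a matrix entry is inspected.
negative-offset : ∀ {n s} → s ℤ.≤ ℤ.- + n ℤ.+ 1ℤ → Fin n → s ≡ 1ℤ ℤ.- (+ (suc ∣ s ∣ ∸ n) ℤ.+ + n)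
negative-offset {suc n} {s} s≤ _ = ≡.trans s≡ (≡.trans (eq₂ (+ n) (+ d))
  (≡.cong (λ t → 1ℤ ℤ.- (+ t ℤ.+ + suc n)) (≡.sym d≡)))
  where
  d : ℕ
  d = ∣ ℤ.- + suc n ℤ.+ 1ℤ ℤ.- s ∣
  eq₁ : ∀ n s → s ≡ ℤ.- (n ℤ.+ (ℤ.- (1ℤ ℤ.+ n) ℤ.+ 1ℤ ℤ.- s))
  eq₁ = solve-∀
  eq₂ : ∀ n d → ℤ.- (n ℤ.+ d) ≡ 1ℤ ℤ.- (d ℤ.+ (1ℤ ℤ.+ n))
  eq₂ = solve-∀
  s≡ : s ≡ ℤ.- + (n ℕ.+ d)
  s≡ = ≡.trans (eq₁ (+ n) s) (≡.cong (λ t → ℤ.- (+ n ℤ.+ t)) (≡.sym (ℤ.0≤i⇒+∣i∣≡i (ℤ.i≤j⇒0≤j-i s≤))))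
  d≡ : ∣ s ∣ ∸ n ≡ d
  d≡ = ≡.trans (≡.cong (λ t → ∣ t ∣ ∸ n) s≡) (≡.trans (≡.cong (_∸ n) (ℤ.∣-i∣≡∣i∣ (+ (n ℕ.+ d)))) (ℕ.m+n∸m≡n n d))

-- Lattice points and paths

-- The state (u , y) is the lattice point at height y with x + y = 2u. Up and
-- level steps increase u by one; down and level steps increase u - y by one.
State : Set
State = ℕ × ℕ

pt : State → Point
pt (u , y) = (+ u ℤ.+ + u ℤ.- + y , + y)

pt-up : ∀ u y → move up (pt (u , y)) ≡ pt (suc u , suc y)
pt-up u y = ≡.cong₂ _,_ (eq (+ u) (+ y)) (ℤ.+-comm (+ y) 1ℤ)
  where
  eq : ∀ u y → u ℤ.+ u ℤ.- y ℤ.+ 1ℤ ≡ (1ℤ ℤ.+ u) ℤ.+ (1ℤ ℤ.+ u) ℤ.- (1ℤ ℤ.+ y)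
  eq = solve-∀

pt-down : ∀ u y → move down (pt (u , suc y)) ≡ pt (u , y)
pt-down u y = ≡.cong₂ _,_ (eq (+ u) (+ y)) ≡.refl
  where
  eq : ∀ u y → u ℤ.+ u ℤ.- (1ℤ ℤ.+ y) ℤ.+ 1ℤ ≡ u ℤ.+ u ℤ.- y
  eq = solve-∀

pt-level : ∀ u y → move level (pt (u , y)) ≡ pt (suc u , y)
pt-level u y = ≡.cong₂ _,_ (eq (+ u) (+ y)) ≡.refl
  where
  eq : ∀ u y → u ℤ.+ u ℤ.- y ℤ.+ + 2 ≡ (1ℤ ℤ.+ u) ℤ.+ (1ℤ ℤ.+ u) ℤ.- y
  eq = solve-∀

-- Every step weakly increases x + y and x - y.
vertices-monotone : ∀ p ts {q} → q ∈ verticesFrom p ts →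
  proj₁ p ℤ.+ proj₂ p ℤ.≤ proj₁ q ℤ.+ proj₂ q × proj₁ p ℤ.- proj₂ p ℤ.≤ proj₁ q ℤ.- proj₂ q
vertices-monotone p []       (here ≡.refl) = ℤ.≤-refl , ℤ.≤-refl
vertices-monotone p (t ∷ ts) (here ≡.refl) = ℤ.≤-refl , ℤ.≤-refl
vertices-monotone p (t ∷ ts) (there q∈) with vertices-monotone (move t p) ts q∈ | move-monotone t p
  where
  grow : ∀ {i j} k → i ℤ.+ + k ≡ j → i ℤ.≤ j
  grow k eq = ≡.subst (_ ℤ.≤_) eq (ℤ.i≤i+j _ (+ k))
  up-sum : ∀ x y → x ℤ.+ y ℤ.+ + 2 ≡ x ℤ.+ 1ℤ ℤ.+ (y ℤ.+ 1ℤ)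
  up-sum = solve-∀
  up-difference : ∀ x y → x ℤ.- y ℤ.+ + 0 ≡ x ℤ.+ 1ℤ ℤ.- (y ℤ.+ 1ℤ)
  up-difference = solve-∀
  down-sum : ∀ x y → x ℤ.+ y ℤ.+ + 0 ≡ x ℤ.+ 1ℤ ℤ.+ (y ℤ.- 1ℤ)
  down-sum = solve-∀
  down-difference : ∀ x y → x ℤ.- y ℤ.+ + 2 ≡ x ℤ.+ 1ℤ ℤ.- (y ℤ.- 1ℤ)
  down-difference = solve-∀
  level-sum : ∀ x y → x ℤ.+ y ℤ.+ + 2 ≡ x ℤ.+ + 2 ℤ.+ y
  level-sum = solve-∀
  level-difference : ∀ x y → x ℤ.- y ℤ.+ + 2 ≡ x ℤ.+ + 2 ℤ.- y
  level-difference = solve-∀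
  move-monotone : ∀ t p →
    proj₁ p ℤ.+ proj₂ p ℤ.≤ proj₁ (move t p) ℤ.+ proj₂ (move t p) ×
    proj₁ p ℤ.- proj₂ p ℤ.≤ proj₁ (move t p) ℤ.- proj₂ (move t p)
  move-monotone up    (x , y) = grow 2 (up-sum x y) , grow 0 (up-difference x y)
  move-monotone down  (x , y) = grow 0 (down-sum x y) , grow 2 (down-difference x y)
  move-monotone level (x , y) = grow 2 (level-sum x y) , grow 2 (level-difference x y)
... | s , d | s′ , d′ = ℤ.≤-trans s′ s , ℤ.≤-trans d′ d

reachable : ∀ {u y u′ y′} ts → pt (u′ , y′) ∈ verticesFrom (pt (u , y)) ts →
            u ℕ.≤ u′ × u ℕ.+ y′ ℕ.≤ u′ ℕ.+ y
reachable {u} {y} {u′} {y′} ts q∈ with s , d ← vertices-monotone _ ts q∈ =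
  halve (ℤ.drop‿+≤+ (≡.subst₂ ℤ._≤_ (sum-eq (+ u) (+ y)) (sum-eq (+ u′) (+ y′)) s)) ,
  -- Adding `2y + 2y′` to both sides clears the subtractions and leaves doubles of natural numbers.
  halve (ℤ.drop‿+≤+ (≡.subst₂ ℤ._≤_ (diff-eq (+ u) (+ y) (+ y′)) (diff-eq′ (+ u′) (+ y) (+ y′))
    (ℤ.+-monoˡ-≤ (+ y ℤ.+ + y ℤ.+ (+ y′ ℤ.+ + y′)) d)))
  where
  halve : ∀ {i j} → i ℕ.+ i ℕ.≤ j ℕ.+ j → i ℕ.≤ j
  halve {i} {j} i+i≤j+j = ℕ.≮⇒≥ λ j<i → ℕ.<⇒≱ (ℕ.+-mono-< j<i j<i) i+i≤j+j
  sum-eq : ∀ u y → u ℤ.+ u ℤ.- y ℤ.+ y ≡ u ℤ.+ u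
  sum-eq = solve-∀
  diff-eq : ∀ u y y′ → u ℤ.+ u ℤ.- y ℤ.- y ℤ.+ (y ℤ.+ y ℤ.+ (y′ ℤ.+ y′)) ≡ u ℤ.+ y′ ℤ.+ (u ℤ.+ y′)
  diff-eq = solve-∀
  diff-eq′ : ∀ u y y′ → u ℤ.+ u ℤ.- y′ ℤ.- y′ ℤ.+ (y ℤ.+ y ℤ.+ (y′ ℤ.+ y′)) ≡ u ℤ.+ y ℤ.+ (u ℤ.+ y)
  diff-eq′ = solve-∀

end∈vertices : ∀ p ts → endFrom p ts ∈ verticesFrom p ts
end∈vertices p []       = here ≡.refl
end∈vertices p (t ∷ ts) = there (end∈vertices (move t p) ts)

start∈vertices : ∀ p ts → p ∈ verticesFrom p ts
start∈vertices p []       = here ≡.refl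
start∈vertices p (t ∷ ts) = here ≡.refl

-- With integer widths the width left after a step may become negative, where there are no words;
-- the first-step decomposition then needs no side condition.
wordsᶻ : ℤ → List (List Step)
wordsᶻ (+ l)    = wordsOfWidth l
wordsᶻ -[1+ _ ] = []

emptyWords : ℤ → List (List Step)
emptyWords (+ zero)  = [] ∷ []
emptyWords (+ suc _) = []
emptyWords -[1+ _ ]  = []

∈-emptyWords : ∀ l {ts} → ts ∈ emptyWords l → ts ≡ []
∈-emptyWords (+ zero) (here eq) = eq

endPoint : ∀ {n} → ℕ → Fin n → Point
endPoint m k = pt (m ℕ.+ toℕ k , toℕ k)

-- The conditions of `S` without the starting points, which vary in the recursion.
record Admissible (m n : ℕ) (P : Fin n → Path) : Set where
  constructor admissible
  field
    schröder        : ∀ k → IsSchröder (P k)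
    ends            : ∀ k → end (P k) ≡ endPoint m k
    nonIntersecting : ∀ j k → j ≢ k → NonIntersecting (P j) (P k)

admissible? : ∀ m n → Decidable (Admissible m n)
admissible? m n P = map′
  (λ (x , y , z) → admissible x y z)
  (λ s → Admissible.schröder s , Admissible.ends s , Admissible.nonIntersecting s)
  (Fin.all? (λ k → All.all? (λ p → 0ℤ ℤ.≤? proj₂ p) (vertices (P k)))
   ×-dec Fin.all? (λ k → end (P k) ≟P endPoint m k)
   ×-dec Fin.all? (λ j → Fin.all? (λ k → ¬? (j Fin.≟ k) →-dec nonIntersecting? (P j) (P k))))
  where open import Relation.Nullary.Decidable using (map′)

-- The two families differ in the single vertex `p`. What `p` could violate, non-negative height and
-- disjointness from the other paths, is covered by the hypotheses.
admissible-step : ∀ {m n} (P P′ : Fin n → Path) k p t ts →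
  P k ≡ path p (t ∷ ts) → P′ k ≡ path (move t p) ts → (∀ i → i ≢ k → P i ≡ P′ i) →
  0ℤ ℤ.≤ proj₂ p → (∀ i → i ≢ k → p ∉ vertices (P′ i)) →
  (Admissible m n P → Admissible m n P′) × (Admissible m n P′ → Admissible m n P)
admissible-step {m} {n} P P′ k p t ts Pk P′k P≡P′ 0≤ p∉ = shorten , extend
  where
  extend-⊆ : ∀ i {q} → q ∈ vertices (P′ i) → q ∈ vertices (P i)
  extend-⊆ i q∈ with i Fin.≟ k
  ... | yes ≡.refl = ≡.subst (λ R → _ ∈ vertices R) (≡.sym Pk) (there (≡.subst (λ R → _ ∈ vertices R) P′k q∈))
  ... | no i≢k     = ≡.subst (λ R → _ ∈ vertices R) (≡.sym (P≡P′ i i≢k)) q∈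
  same-end : ∀ i → end (P i) ≡ end (P′ i)
  same-end i with i Fin.≟ k
  ... | yes ≡.refl = ≡.trans (≡.cong end Pk) (≡.cong end (≡.sym P′k))
  ... | no i≢k     = ≡.cong end (P≡P′ i i≢k)
  shorten : Admissible m n P → Admissible m n P′
  shorten (admissible s e d) = admissible
    (λ i → All.tabulate λ q∈ → All.lookup (s i) (extend-⊆ i q∈))
    (λ i → ≡.trans (≡.sym (same-end i)) (e i))
    (λ i j i≢j (q∈ , q∈′) → d i j i≢j (extend-⊆ i q∈ , extend-⊆ j q∈′))
  at-most : ∀ i {q} → q ∈ vertices (P i) → (i ≡ k × q ≡ p) ⊎ q ∈ vertices (P′ i)
  at-most i q∈ with i Fin.≟ k
  ... | no i≢k = inj₂ (≡.subst (λ R → _ ∈ vertices R) (P≡P′ i i≢k) q∈)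
  ... | yes ≡.refl with ≡.subst (λ R → _ ∈ vertices R) Pk q∈
  ...   | here q≡p  = inj₁ (≡.refl , q≡p)
  ...   | there q∈′ = inj₂ (≡.subst (λ R → _ ∈ vertices R) (≡.sym P′k) q∈′)
  extend : Admissible m n P′ → Admissible m n P
  extend (admissible s e d) = admissible
    (λ i → All.tabulate λ q∈ → nonneg i (at-most i q∈))
    (λ i → ≡.trans (same-end i) (e i))
    (λ i j i≢j (q∈ , q∈′) → disjoint i j i≢j (at-most i q∈) (at-most j q∈′))
    where
    nonneg : ∀ i {q} → (i ≡ k × q ≡ p) ⊎ q ∈ vertices (P′ i) → 0ℤ ℤ.≤ proj₂ q
    nonneg i (inj₁ (_ , ≡.refl)) = 0≤
    nonneg i (inj₂ q∈)           = All.lookup (s i) q∈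
    disjoint : ∀ i j {q} → i ≢ j → (i ≡ k × q ≡ p) ⊎ q ∈ vertices (P′ i) →
               ¬ ((j ≡ k × q ≡ p) ⊎ q ∈ vertices (P′ j))
    disjoint i j i≢j (inj₁ (≡.refl , _))      (inj₁ (j≡k , _))         = i≢j (≡.sym j≡k)
    disjoint i j i≢j (inj₁ (≡.refl , ≡.refl)) (inj₂ q∈)                = p∉ j (i≢j ∘ ≡.sym) q∈
    disjoint i j i≢j (inj₂ q∈)                (inj₁ (≡.refl , ≡.refl)) = p∉ i i≢j q∈
    disjoint i j i≢j (inj₂ q∈)                (inj₂ q∈′)               = d i j i≢j (q∈ , q∈′)

-- Comparison of the coordinates u - y, without subtraction.
infix 4 _≤ʷ_ _<ʷ_
_≤ʷ_ _<ʷ_ : State → State → Set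
(u , y) ≤ʷ (u′ , y′) = u ℕ.+ y′ ℕ.≤ u′ ℕ.+ y
(u , y) <ʷ (u′ , y′) = u ℕ.+ y′ ℕ.< u′ ℕ.+ y

private
  exchange : ∀ p q r s → (p ℕ.+ q) ℕ.+ (r ℕ.+ s) ≡ (r ℕ.+ q) ℕ.+ (p ℕ.+ s)
  exchange = ℕ-Solver.+-*-Solver.solve 4 (λ p q r s → (p :+′ q) :+′ (r :+′ s) :=′ (r :+′ q) :+′ (p :+′ s)) ≡.refl
    where open ℕ-Solver.+-*-Solver renaming (_:+_ to _:+′_; _:=_ to _:=′_)
  exchange′ : ∀ p q r s → (p ℕ.+ q) ℕ.+ (r ℕ.+ s) ≡ (p ℕ.+ s) ℕ.+ (r ℕ.+ q)
  exchange′ = ℕ-Solver.+-*-Solver.solve 4 (λ p q r s → (p :+′ q) :+′ (r :+′ s) :=′ (p :+′ s) :+′ (r :+′ q)) ≡.refl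
    where open ℕ-Solver.+-*-Solver renaming (_:+_ to _:+′_; _:=_ to _:=′_)

≤ʷ-trans : ∀ s t r → s ≤ʷ t → t ≤ʷ r → s ≤ʷ r
≤ʷ-trans (u₁ , y₁) (u₂ , y₂) (u₃ , y₃) s≤t t≤r = ℕ.+-cancelˡ-≤ (u₂ ℕ.+ y₂) _ _
  (≡.subst₂ ℕ._≤_ (exchange u₁ y₂ u₂ y₃) (exchange′ u₂ y₁ u₃ y₂) (ℕ.+-mono-≤ s≤t t≤r))

last-least : ∀ {n} (a : Fin n → State) → (∀ i j → toℕ i ℕ.< toℕ j → a j ≤ʷ a i) →
             Fin n → ∃ λ k → ∀ i → a k ≤ʷ a i
last-least {suc n} a w-mono _ = fromℕ n , least-at
  where
  least-at : ∀ i → a (fromℕ n) ≤ʷ a i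
  least-at i with i Fin.≟ fromℕ n
  ... | yes ≡.refl = ℕ.≤-refl
  ... | no i≢      = w-mono i (fromℕ n) (ℕ.≤∧≢⇒< (≡.subst (toℕ i ℕ.≤_) (≡.sym (Fin.toℕ-fromℕ n)) (Fin.toℕ≤pred[n] i)) (i≢ ∘ Fin.toℕ-injective))

module _ {a ℓ₁ ℓ₂} (K : HeytingField a ℓ₁ ℓ₂) where

  open HeytingField K using (_#_)
  open Over K renaming (const to constant)
  open CommutativeRing K-commutativeRing hiding (zero)
  open import Algebra.Properties.Semiring.Sum semiring
    using (sum-cong-≋; sum-remove; sum-replicate-zero; ∑-distrib-+; *-distribˡ-sum)
  import Algebra.Properties.CommutativeMonoid.Sum *-commutativeMonoid as Product
  open import Algebra.Properties.Semiring.Exp semiring using (^-homo-*; ^-congʳ)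
  open import Algebra.Properties.Ring ring
    using (-1*x≈-x; -‿distribˡ-*; -0#≈0#; -‿+-comm; +-cancelʳ)
  open import Algebra.Solver.Ring.NaturalCoefficients.Default commutativeSemiring
    using (solve; _:=_; _:+_; _:*_; con)
  open import Relation.Binary.Reasoning.Setoid setoid hiding (start)

  -- Determinants

  Matrix : ℕ → Set a
  Matrix n = Fin n → Fin n → Carrier

  minor : ∀ {n} → Matrix (suc n) → Fin (suc n) → Matrix n
  minor A k i j = A (suc i) (punchIn k j)

  sum-zero : ∀ {n} (t : Fin n → Carrier) → (∀ i → t i ≈ 0#) → sum t ≈ 0#
  sum-zero {n} t t≈0 = trans (sum-cong-≋ t≈0) (sum-replicate-zero n)

  sum-single : ∀ {n} (k : Fin n) (t : Fin n → Carrier) → (∀ i → i ≢ k → t i ≈ 0#) → sum t ≈ t k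
  sum-single {suc n} k t t≈0 = begin
    sum t                          ≈⟨ sum-remove {i = k} t ⟩
    t k + sum (t ∘ punchIn k)      ≈⟨ +-congˡ (sum-zero _ λ i → t≈0 _ (Fin.punchInᵢ≢i k i)) ⟩
    t k + 0#                       ≈⟨ +-identityʳ _ ⟩
    t k                            ∎

  sum-pair : ∀ {n} (k : Fin n) (t : Fin (suc n) → Carrier) →
             (∀ i → i ≢ inject₁ k → i ≢ suc k → t i ≈ 0#) →
             t (inject₁ k) + t (suc k) ≈ 0# → sum t ≈ 0#
  sum-pair {suc n} zero t t≈0 eq = begin
    t zero + (t (suc zero) + sum (λ i → t (suc (suc i))))
      ≈⟨ +-congˡ (+-congˡ (sum-zero _ λ i → t≈0 (suc (suc i)) (λ ()) (λ ()))) ⟩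
    t zero + (t (suc zero) + 0#)  ≈⟨ +-congˡ (+-identityʳ _) ⟩
    t zero + t (suc zero)         ≈⟨ eq ⟩
    0#                            ∎
  sum-pair {suc n} (suc k) t t≈0 eq =
    trans (+-cong (t≈0 zero (λ ()) (λ ()))
                  (sum-pair k (t ∘ suc) (λ i p q → t≈0 (suc i) (p ∘ Fin.suc-injective) (q ∘ Fin.suc-injective)) eq))
          (+-identityˡ 0#)

  det-cong : ∀ {n} {A B : Matrix n} → (∀ i j → A i j ≈ B i j) → det A ≈ det B
  det-cong {zero}  A≈B = refl
  det-cong {suc n} A≈B = sum-cong-≋ λ k →
    *-cong (*-congˡ {x = (- 1#) ^ toℕ k} (A≈B zero k)) (det-cong λ i j → A≈B (suc i) (punchIn k j))

  -- Additivity and homogeneity at once. In the first-row expansion the term of column `k` has a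
  -- linear entry and an unchanged minor; every other term has a fixed entry and, by induction, a
  -- minor linear in the place where column `k` lands.
  det-linear : ∀ {n} (k : Fin n) (x : Carrier) (A B C : Matrix n) →
               (∀ i j → j ≢ k → A i j ≈ C i j) → (∀ i j → j ≢ k → B i j ≈ C i j) →
               (∀ i → C i k ≈ x * A i k + B i k) → det C ≈ x * det A + det B
  det-linear {suc n} k x A B C A≈C B≈C Ck = begin
    det C                                ≈⟨ sum-cong-≋ expand ⟩
    sum (λ l → x * term A l + term B l)  ≈⟨ ∑-distrib-+ (λ l → x * term A l) (term B) ⟩
    sum (λ l → x * term A l) + det B     ≈⟨ +-congʳ (*-distribˡ-sum x (term A)) ⟨
    x * det A + det B                    ∎
    where
    term : Matrix (suc n) → Fin (suc n) → Carrier
    term M l = (- 1#) ^ toℕ l * M zero l * det (minor M l)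
    expand : ∀ l → term C l ≈ x * term A l + term B l
    expand l with l Fin.≟ k
    ... | yes ≡.refl = begin
      (- 1#) ^ toℕ l * C zero l * det (minor C l)
        ≈⟨ *-congʳ (*-congˡ (Ck zero)) ⟩
      (- 1#) ^ toℕ l * (x * A zero l + B zero l) * det (minor C l)
        ≈⟨ solve 5 (λ s x a b d → s :* (x :* a :+ b) :* d := x :* (s :* a :* d) :+ s :* b :* d) refl
             ((- 1#) ^ toℕ l) x (A zero l) (B zero l) (det (minor C l)) ⟩
      x * ((- 1#) ^ toℕ l * A zero l * det (minor C l)) + (- 1#) ^ toℕ l * B zero l * det (minor C l)
        ≈⟨ +-cong (*-congˡ (*-congˡ (det-cong λ i j → A≈C _ _ (Fin.punchInᵢ≢i l j))))
                  (*-congˡ (det-cong λ i j → B≈C _ _ (Fin.punchInᵢ≢i l j))) ⟨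
      x * term A l + term B l ∎
    ... | no l≢k = begin
      s * C zero l * det (minor C l)
        ≈⟨ *-congˡ (det-linear k′ x (minor A l) (minor B l) (minor C l)
             (λ i j p → A≈C _ _ (off p)) (λ i j p → B≈C _ _ (off p))
             (λ i → ≡.subst (λ m → C (suc i) m ≈ x * A (suc i) m + B (suc i) m) (≡.sym at-k) (Ck (suc i)))) ⟩
      s * C zero l * (x * det (minor A l) + det (minor B l))
        ≈⟨ solve 5 (λ s c x d e → s :* c :* (x :* d :+ e) := x :* (s :* c :* d) :+ s :* c :* e) refl
             s (C zero l) x (det (minor A l)) (det (minor B l)) ⟩
      x * (s * C zero l * det (minor A l)) + s * C zero l * det (minor B l)
        ≈⟨ +-cong (*-congˡ (*-congʳ (*-congˡ (A≈C zero l l≢k)))) (*-congʳ (*-congˡ (B≈C zero l l≢k))) ⟨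
      x * term A l + term B l ∎
      where
      s = (- 1#) ^ toℕ l
      k′ = punchOut l≢k
      at-k : punchIn l k′ ≡ k
      at-k = Fin.punchIn-punchOut l≢k
      off : ∀ {j} → j ≢ k′ → punchIn l j ≢ k
      off p eq = p (Fin.punchIn-injective l _ _ (≡.trans eq (≡.sym at-k)))

  -1*x+x≈0 : ∀ x → - 1# * x + x ≈ 0#
  -1*x+x≈0 x = trans (+-congʳ (-1*x≈-x x)) (-‿inverseˡ x)

  -- A zero column is -1 times itself plus itself, and linearity passes this relation on to the
  -- determinant.
  det-zero-column : ∀ {n} (k : Fin n) (A : Matrix n) → (∀ i → A i k ≈ 0#) → det A ≈ 0#
  det-zero-column k A Ak≈0 = trans
    (det-linear k (- 1#) A A A (λ _ _ _ → refl) (λ _ _ _ → refl)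
      (λ i → trans (Ak≈0 i) (sym (-1*x+x≈0 (A i k)))))
    (-1*x+x≈0 (det A))

  -- In the first-row expansion the minors that keep both columns vanish by induction; the two
  -- others coincide and carry opposite signs. Antisymmetry would not suffice as a starting point,
  -- since 2 may vanish in `K`.
  det-equal-adjacent : ∀ {n} (k : Fin n) (A : Matrix (suc n)) →
                       (∀ i → A i (inject₁ k) ≈ A i (suc k)) → det A ≈ 0#
  det-equal-adjacent {suc n} k A eq = sum-pair k _ vanish cancel
    where
    vanish : ∀ l → l ≢ inject₁ k → l ≢ suc k →
             (- 1#) ^ toℕ l * A zero l * det (minor A l) ≈ 0#
    vanish l p q with k′ , e₁ , e₂ ← punchIn-avoid l k p q = trans
      (*-congˡ (det-equal-adjacent k′ (minor A l) λ i → begin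
        A (suc i) (punchIn l (inject₁ k′))  ≡⟨ ≡.cong (A (suc i)) e₁ ⟩
        A (suc i) (inject₁ k)               ≈⟨ eq (suc i) ⟩
        A (suc i) (suc k)                   ≡⟨ ≡.cong (A (suc i)) e₂ ⟨
        A (suc i) (punchIn l (suc k′))      ∎))
      (zeroʳ _)
    minors : det (minor A (inject₁ k)) ≈ det (minor A (suc k))
    minors = det-cong λ i j → same i j (punchIn-adjacent k j)
      where
      same : ∀ i j → punchIn (inject₁ k) j ≡ punchIn (suc k) j ⊎
             punchIn (inject₁ k) j ≡ suc k × punchIn (suc k) j ≡ inject₁ k →
             A (suc i) (punchIn (inject₁ k) j) ≈ A (suc i) (punchIn (suc k) j)
      same i j (inj₁ e)         = reflexive (≡.cong (A (suc i)) e)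
      same i j (inj₂ (e₁ , e₂)) = begin
        A (suc i) (punchIn (inject₁ k) j)  ≡⟨ ≡.cong (A (suc i)) e₁ ⟩
        A (suc i) (suc k)                  ≈⟨ eq (suc i) ⟨
        A (suc i) (inject₁ k)              ≡⟨ ≡.cong (A (suc i)) e₂ ⟨
        A (suc i) (punchIn (suc k) j)      ∎
    cancel : (- 1#) ^ toℕ (inject₁ k) * A zero (inject₁ k) * det (minor A (inject₁ k))
             + (- 1#) * (- 1#) ^ toℕ k * A zero (suc k) * det (minor A (suc k)) ≈ 0#
    cancel = begin
      (- 1#) ^ toℕ (inject₁ k) * A zero (inject₁ k) * det (minor A (inject₁ k))
        + (- 1#) * (- 1#) ^ toℕ k * A zero (suc k) * d
        ≈⟨ +-congʳ (*-cong (*-cong (reflexive (≡.cong ((- 1#) ^_) (Fin.toℕ-inject₁ k))) (eq zero)) minors) ⟩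
      s * A zero (suc k) * d + (- 1#) * s * A zero (suc k) * d
        ≈⟨ solve 4 (λ m s x d → s :* x :* d :+ m :* s :* x :* d := m :* (s :* x :* d) :+ s :* x :* d)
             refl (- 1#) s (A zero (suc k)) d ⟩
      - 1# * (s * A zero (suc k) * d) + s * A zero (suc k) * d
        ≈⟨ -1*x+x≈0 _ ⟩
      0# ∎
      where
      s = (- 1#) ^ toℕ k
      d = det (minor A (suc k))

  abstract
    -- Opaque, so that nested replacements are handled only through the two laws that follow.
    setColumn : ∀ {n} → Matrix n → Fin n → (Fin n → Carrier) → Matrix n
    setColumn A k v i = updateAt (A i) k (const (v i))

    setColumn-at : ∀ {n} (A : Matrix n) k v i → setColumn A k v i k ≈ v i
    setColumn-at A k v i = reflexive (updateAt-updates k (A i))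

    setColumn-off : ∀ {n} (A : Matrix n) k v i j → j ≢ k → setColumn A k v i j ≈ A i j
    setColumn-off A k v i j j≢k = reflexive (updateAt-minimal j k (A i) j≢k)

  -- Polarisation: the determinant with the sum of the two columns in both places vanishes, and so
  -- do the terms with one column twice; the two mixed terms remain.
  det-swap-adjacent : ∀ {n} (k : Fin n) (A B : Matrix (suc n)) →
    (∀ i j → j ≢ inject₁ k → j ≢ suc k → A i j ≈ B i j) →
    (∀ i → A i (inject₁ k) ≈ B i (suc k)) → (∀ i → A i (suc k) ≈ B i (inject₁ k)) →
    det A + det B ≈ 0#
  det-swap-adjacent {n} k A B off e₁ e₂ = begin
    det A + det B
      ≈⟨ solve 2 (λ a b → a :+ b := con 1 :* (con 1 :* con 0 :+ a) :+ (con 1 :* b :+ con 0)) refl (det A) (det B) ⟩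
    1# * (1# * 0# + det A) + (1# * det B + 0#)
      ≈⟨ +-cong (*-congˡ (+-cong (*-congˡ (equal p)) (det-cong X-A))) (+-cong (*-congˡ (det-cong X-B)) (equal q)) ⟨
    1# * (1# * det (X p p) + det (X p q)) + (1# * det (X q p) + det (X q q))
      ≈⟨ +-cong (*-congˡ (split p)) (split q) ⟨
    1# * det (X p r) + det (X q r)
      ≈⟨ det-linear (inject₁ k) 1# (X p r) (X q r) (X r r)
           (λ i j j≢ → outer i j j≢ p) (λ i j j≢ → outer i j j≢ q)
           (λ i → trans (X-left r r i) (+-cong (*-congˡ (sym (X-left p r i))) (sym (X-left q r i)))) ⟨
    det (X r r)
      ≈⟨ equal r ⟩
    0# ∎
    where
    p q r : Fin (suc n) → Carrier
    p i = A i (inject₁ k)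
    q i = A i (suc k)
    -- The factor 1 makes the sum an instance of `det-linear`.
    r i = 1# * p i + q i
    X : (u v : Fin (suc n) → Carrier) → Matrix (suc n)
    X u v = setColumn (setColumn A (inject₁ k) u) (suc k) v
    X-left : ∀ u v i → X u v i (inject₁ k) ≈ u i
    X-left u v i = trans (setColumn-off _ (suc k) v i _ (inject₁≢suc k)) (setColumn-at A _ u i)
    X-right : ∀ u v i → X u v i (suc k) ≈ v i
    X-right u v i = setColumn-at _ (suc k) v i
    X-off : ∀ u v i j → j ≢ inject₁ k → j ≢ suc k → X u v i j ≈ A i j
    X-off u v i j j≢ j≢′ = trans (setColumn-off _ (suc k) v i j j≢′) (setColumn-off A _ u i j j≢)
    equal : ∀ u → det (X u u) ≈ 0#
    equal u = det-equal-adjacent k (X u u) λ i → trans (X-left u u i) (sym (X-right u u i))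
    outer : ∀ i j → j ≢ inject₁ k → ∀ u → X u r i j ≈ X r r i j
    outer i j j≢ u with j Fin.≟ suc k
    ... | yes ≡.refl = trans (X-right u r i) (sym (X-right r r i))
    ... | no j≢′     = trans (X-off u r i j j≢ j≢′) (sym (X-off r r i j j≢ j≢′))
    split : ∀ u → det (X u r) ≈ 1# * det (X u p) + det (X u q)
    split u = det-linear (suc k) 1# (X u p) (X u q) (X u r) (inner p) (inner q)
      (λ i → trans (X-right u r i) (+-cong (*-congˡ (sym (X-right u p i))) (sym (X-right u q i))))
      where
      inner : ∀ v i j → j ≢ suc k → X u v i j ≈ X u r i j
      inner v i j j≢ = trans (setColumn-off _ (suc k) v i j j≢) (sym (setColumn-off _ (suc k) r i j j≢))
    X-A : ∀ i j → X p q i j ≈ A i j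
    X-A i j with j Fin.≟ inject₁ k | j Fin.≟ suc k
    ... | yes ≡.refl | _          = X-left p q i
    ... | no j≢      | yes ≡.refl = X-right p q i
    ... | no j≢      | no j≢′     = X-off p q i j j≢ j≢′
    X-B : ∀ i j → X q p i j ≈ B i j
    X-B i j with j Fin.≟ inject₁ k | j Fin.≟ suc k
    ... | yes ≡.refl | _          = trans (X-left q p i) (e₂ i)
    ... | no j≢      | yes ≡.refl = trans (X-right q p i) (e₁ i)
    ... | no j≢      | no j≢′     = trans (X-off q p i j j≢ j≢′) (off i j j≢ j≢′)

  -- Induction on the number `d` of columns between the two: an adjacent swap brings the right one
  -- closer and only changes the sign.
  det-equal-< : ∀ {n} (d : ℕ) (i : Fin (suc n)) (k : Fin n) (A : Matrix (suc n)) →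
                toℕ k ≡ toℕ i ℕ.+ d → (∀ r → A r i ≈ A r (suc k)) → det A ≈ 0#
  det-equal-< zero i k A k≡i eq = det-equal-adjacent k A λ r → begin
    A r (inject₁ k)  ≡⟨ ≡.cong (A r) (Fin.toℕ-injective (≡.trans (Fin.toℕ-inject₁ k) (≡.trans k≡i (ℕ.+-identityʳ _)))) ⟩
    A r i            ≈⟨ eq r ⟩
    A r (suc k)      ∎
  det-equal-< (suc d) i zero A 0≡ eq with () ← ≡.trans 0≡ (ℕ.+-suc (toℕ i) d)
  det-equal-< {suc n} (suc d) i (suc k) A k≡ eq = begin
    det A          ≈⟨ +-identityʳ _ ⟨
    det A + 0#     ≈⟨ +-congˡ (det-equal-< d i (inject₁ k) B gap equal) ⟨
    det A + det B  ≈⟨ det-swap-adjacent (suc k) A B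
                        (λ r j j≢ j≢′ → sym (trans (setColumn-off _ _ _ r j j≢′) (setColumn-off _ _ _ r j j≢)))
                        (λ r → sym (setColumn-at _ _ _ r)) (λ r → sym (B-left r)) ⟩
    0#             ∎
    where
    B : Matrix _
    B = setColumn (setColumn A (inject₁ (suc k)) (λ r → A r (suc (suc k)))) (suc (suc k)) (λ r → A r (inject₁ (suc k)))
    gap′ : toℕ k ≡ toℕ i ℕ.+ d
    gap′ = ℕ.suc-injective (≡.trans k≡ (ℕ.+-suc (toℕ i) d))
    gap : toℕ (inject₁ k) ≡ toℕ i ℕ.+ d
    gap = ≡.trans (Fin.toℕ-inject₁ k) gap′
    i<k : toℕ i ℕ.< toℕ (suc k)
    i<k = s≤s (≡.subst (toℕ i ℕ.≤_) (≡.sym gap′) (ℕ.m≤m+n _ d))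
    B-left : ∀ r → B r (suc (inject₁ k)) ≈ A r (suc (suc k))
    B-left r = trans (setColumn-off _ (suc (suc k)) _ r _ (inject₁≢suc (suc k))) (setColumn-at A (inject₁ (suc k)) _ r)
    equal : ∀ r → B r i ≈ B r (suc (inject₁ k))
    equal r = begin
      B r i            ≈⟨ setColumn-off _ (suc (suc k)) _ r i (λ e → ℕ.<⇒≢ (ℕ.<-trans i<k (ℕ.n<1+n _)) (≡.cong toℕ e)) ⟩
      _                ≈⟨ setColumn-off A (inject₁ (suc k)) _ r i
                            (λ e → ℕ.<⇒≢ i<k (≡.trans (≡.cong toℕ e) (Fin.toℕ-inject₁ (suc k)))) ⟩
      A r i            ≈⟨ eq r ⟩
      A r (suc (suc k)) ≈⟨ B-left r ⟨
      B r (suc (inject₁ k)) ∎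

  det-equal-columns : ∀ {n} (i j : Fin n) (A : Matrix n) → i ≢ j → (∀ r → A r i ≈ A r j) → det A ≈ 0#
  det-equal-columns i j A i≢j eq with ℕ.<-cmp (toℕ i) (toℕ j)
  det-equal-columns i (suc k) A i≢j eq | tri< (s≤s i≤k) _ _ =
    det-equal-< (toℕ k ℕ.∸ toℕ i) i k A (≡.sym (ℕ.m+[n∸m]≡n i≤k)) eq
  ... | tri≈ _ i≡j _ = contradiction (Fin.toℕ-injective i≡j) i≢j
  det-equal-columns (suc k) j A i≢j eq | tri> _ _ (s≤s j≤k) =
    det-equal-< (toℕ k ℕ.∸ toℕ j) j k A (≡.sym (ℕ.m+[n∸m]≡n j≤k)) (λ r → sym (eq r))

  det-scale : ∀ {n} (x : Carrier) (A : Matrix n) → det (λ i j → x * A i j) ≈ x ^ n * det A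
  det-scale {zero}  x A = sym (*-identityˡ 1#)
  det-scale {suc n} x A = begin
    sum (λ k → (- 1#) ^ toℕ k * (x * A zero k) * det (λ i j → x * minor A k i j))
      ≈⟨ sum-cong-≋ (λ k → trans (*-congˡ (det-scale x (minor A k)))
           (solve 5 (λ s x y p d → s :* (x :* y) :* (p :* d) := x :* p :* (s :* y :* d)) refl
              ((- 1#) ^ toℕ k) x (A zero k) (x ^ n) (det (minor A k)))) ⟩
    sum (λ k → x ^ suc n * ((- 1#) ^ toℕ k * A zero k * det (minor A k)))
      ≈⟨ *-distribˡ-sum {suc n} (x ^ suc n) (λ k → (- 1#) ^ toℕ k * A zero k * det (minor A k)) ⟨
    x ^ suc n * det A ∎

  -- The sign of the permutation that reverses n objects.
  reversalSign : ℕ → Carrier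
  reversalSign zero    = 1#
  reversalSign (suc n) = (- 1#) ^ n * reversalSign n

  -- In both antitriangular shapes only the last term of the first-row expansion survives: in one
  -- the other minors vanish, in the other the other entries do. The hypothesis on the product
  -- covers both.
  det-antitriangular-step : ∀ {n} (A : Matrix (suc n)) →
    (∀ l → l ≢ fromℕ n → A zero l * det (minor A l) ≈ 0#) →
    det (λ i j → A (suc i) (inject₁ j)) ≈ reversalSign n * product (λ i → A (suc i) (inject₁ (opposite i))) →
    det A ≈ reversalSign (suc n) * product (λ i → A i (opposite i))
  det-antitriangular-step {n} A vanish ih = begin
    det A
      ≈⟨ sum-single (fromℕ n) _ (λ l l≢ → trans (*-assoc ((- 1#) ^ toℕ l) _ _) (trans (*-congˡ (vanish l l≢)) (zeroʳ _))) ⟩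
    (- 1#) ^ toℕ (fromℕ n) * A zero (fromℕ n) * det (minor A (fromℕ n))
      ≈⟨ *-cong (*-congʳ (reflexive (≡.cong ((- 1#) ^_) (Fin.toℕ-fromℕ n))))
           (trans (det-cong λ i j → reflexive (≡.cong (A (suc i)) (punchIn-last j))) ih) ⟩
    (- 1#) ^ n * A zero (fromℕ n) * (reversalSign n * product (λ i → A (suc i) (inject₁ (opposite i))))
      ≈⟨ solve 4 (λ s x r p → s :* x :* (r :* p) := s :* r :* (x :* p)) refl _ _ _ _ ⟩
    reversalSign (suc n) * product (λ i → A i (opposite i)) ∎

  -- Deleting any column but the last keeps the last column in the minor, and below the first row
  -- that column is zero.
  det-upper-antitriangular : ∀ {n} (A : Matrix n) → (∀ i j → n ℕ.≤ toℕ i ℕ.+ toℕ j → A i j ≈ 0#) →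
    det A ≈ reversalSign n * product (λ i → A i (opposite i))
  det-upper-antitriangular {zero}  A A≈0 = sym (*-identityˡ 1#)
  det-upper-antitriangular {suc n} A A≈0 = det-antitriangular-step A
    (λ l l≢ → trans (*-congˡ (minor≈0 l l≢)) (zeroʳ _))
    (det-upper-antitriangular (λ i j → A (suc i) (inject₁ j))
      λ i j n≤ → A≈0 (suc i) (inject₁ j) (s≤s (≡.subst (λ t → n ℕ.≤ toℕ i ℕ.+ t) (≡.sym (Fin.toℕ-inject₁ j)) n≤)))
    where
    punchIn-fromℕ : ∀ {n} (l : Fin (suc (suc n))) → l ≢ fromℕ (suc n) → punchIn l (fromℕ n) ≡ fromℕ (suc n)
    punchIn-fromℕ zero l≢ = ≡.refl
    punchIn-fromℕ {zero} (suc zero) l≢ = contradiction ≡.refl l≢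
    punchIn-fromℕ {suc n} (suc l) l≢ = ≡.cong suc (punchIn-fromℕ l (l≢ ∘ ≡.cong suc))
    minor≈0 : ∀ l → l ≢ fromℕ n → det (minor A l) ≈ 0#
    minor≈0 = last-column A A≈0
      where
      last-column : ∀ {n} (A : Matrix (suc n)) → (∀ i j → suc n ℕ.≤ toℕ i ℕ.+ toℕ j → A i j ≈ 0#) →
                    ∀ l → l ≢ fromℕ n → det (minor A l) ≈ 0#
      last-column {zero}  A A≈0 zero l≢ = contradiction ≡.refl l≢
      last-column {suc n} A A≈0 l    l≢ = det-zero-column (fromℕ n) (minor A l) λ i →
        trans (reflexive (≡.cong (A (suc i)) (punchIn-fromℕ l l≢)))
              (A≈0 (suc i) (fromℕ (suc n)) (s≤s (ℕ.≤-trans (ℕ.≤-reflexive (≡.sym (Fin.toℕ-fromℕ (suc n)))) (ℕ.m≤n+m _ (toℕ i)))))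

  det-lower-antitriangular : ∀ {n} (A : Matrix n) → (∀ i j → suc (toℕ i ℕ.+ toℕ j) ℕ.< n → A i j ≈ 0#) →
    det A ≈ reversalSign n * product (λ i → A i (opposite i))
  det-lower-antitriangular {zero}  A A≈0 = sym (*-identityˡ 1#)
  det-lower-antitriangular {suc n} A A≈0 = det-antitriangular-step A
    (λ l l≢ → trans (*-congʳ (A≈0 zero l (s≤s (ℕ.≤∧≢⇒< (Fin.toℕ≤pred[n] l)
      (λ e → l≢ (Fin.toℕ-injective (≡.trans e (≡.sym (Fin.toℕ-fromℕ n))))))))) (zeroˡ _))
    (det-lower-antitriangular (λ i j → A (suc i) (inject₁ j))
      λ i j <n → A≈0 (suc i) (inject₁ j) (s≤s (≡.subst (λ t → suc (toℕ i ℕ.+ t) ℕ.< n) (≡.sym (Fin.toℕ-inject₁ j)) <n)))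

  -- Alternating multilinear forms

  -- The first index selects the argument: A k is the k-th argument of the form.
  record AlternatingForm (n : ℕ) : Set (a ⊔ ℓ₁) where
    field
      form        : Matrix n → Carrier
      form-cong   : ∀ {A B} → (∀ i j → A i j ≈ B i j) → form A ≈ form B
      linear      : ∀ k x A B C → (∀ i → i ≢ k → ∀ j → A i j ≈ C i j) →
                    (∀ i → i ≢ k → ∀ j → B i j ≈ C i j) →
                    (∀ j → C k j ≈ x * A k j + B k j) → form C ≈ x * form A + form B
      alternating : ∀ i i′ A → i ≢ i′ → (∀ j → A i j ≈ A i′ j) → form A ≈ 0#
      -- The sign is part of the law because both instances reverse one index of a determinant,
      -- which carries the triangular shape to an antitriangular one.
      triangular  : ∀ A → (∀ i j → toℕ j ℕ.< toℕ i → A i j ≈ 0#) →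
                    form A ≈ reversalSign n * product (λ i → A i i)

    form-zero : ∀ k A → (∀ j → A k j ≈ 0#) → form A ≈ 0#
    form-zero k A Ak≈0 = trans
      (linear k (- 1#) A A A (λ _ _ _ → refl) (λ _ _ _ → refl)
        (λ j → trans (Ak≈0 j) (sym (-1*x+x≈0 (A k j)))))
      (-1*x+x≈0 (form A))

    replace : Matrix n → Fin n → (Fin n → Carrier) → Carrier
    replace A k v = form (updateAt A k (const v))

    replace-linear : ∀ A k x u v w → (∀ j → w j ≈ x * u j + v j) →
                     replace A k w ≈ x * replace A k u + replace A k v
    replace-linear A k x u v w eq = linear k x _ _ _
      (λ i i≢k j → trans (off u i i≢k j) (sym (off w i i≢k j)))
      (λ i i≢k j → trans (off v i i≢k j) (sym (off w i i≢k j)))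
      (λ j → trans (at w j) (trans (eq j) (sym (+-cong (*-congˡ (at u j)) (at v j)))))
      where
      at : ∀ v j → updateAt A k (const v) k j ≈ v j
      at v j = reflexive (≡.cong-app (updateAt-updates k A) j)
      off : ∀ v i → i ≢ k → ∀ j → updateAt A k (const v) i j ≈ A i j
      off v i i≢k j = reflexive (≡.cong-app (updateAt-minimal i k A i≢k) j)

  -- The form for `s ≥ n`. Its arguments are the columns; the row index of `f (s - j + k)` is
  -- reversed so that the index of the moment grows with both.
  detReversedRows : ∀ n → AlternatingForm n
  detReversedRows n = record
    { form        = λ A → det (λ j k → A k (opposite j))
    ; form-cong   = λ A≈B → det-cong λ j k → A≈B k (opposite j)
    ; linear      = λ k x A B C A≈C B≈C Ck → det-linear k x _ _ _
        (λ j i i≢k → A≈C i i≢k (opposite j)) (λ j i i≢k → B≈C i i≢k (opposite j)) (λ j → Ck (opposite j))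
    ; alternating = λ i i′ A i≢i′ eq → det-equal-columns i i′ _ i≢i′ (λ j → eq (opposite j))
    ; triangular  = λ A A≈0 → trans
        (det-upper-antitriangular _ λ i j n≤ → A≈0 j (opposite i) (n≤i+j⇒opposite-i<j i j n≤))
        (*-congˡ (sym (Product.sum-permute (λ i → A i i) Perm.reverse)))
    }

  -- The form for `s ≤ 1 - n`. There the negated index of the moment has to grow, so the arguments
  -- are the columns in reverse order.
  detReversedColumns : ∀ n → AlternatingForm n
  detReversedColumns n = record
    { form        = λ A → det (λ j k → A (opposite k) j)
    ; form-cong   = λ A≈B → det-cong λ j k → A≈B (opposite k) j
    ; linear      = λ k x A B C A≈C B≈C Ck → det-linear (opposite k) x _ _ _
        (λ j i i≢k → A≈C (opposite i) (opposite-cong-≢ i≢k) j)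
        (λ j i i≢k → B≈C (opposite i) (opposite-cong-≢ i≢k) j)
        (λ j → ≡.subst (λ l → C l j ≈ x * A l j + B l j) (≡.sym (Fin.opposite-involutive k)) (Ck j))
    ; alternating = λ i i′ A i≢i′ eq → det-equal-columns (opposite i) (opposite i′) _
        (λ e → opposite-cong-≢ {i = i} {k = opposite i′}
          (λ e′ → i≢i′ (≡.trans e′ (Fin.opposite-involutive i′))) e)
        (λ j → begin
          A (opposite (opposite i)) j   ≡⟨ ≡.cong (λ l → A l j) (Fin.opposite-involutive i) ⟩
          A i j                         ≈⟨ eq j ⟩
          A i′ j                        ≡⟨ ≡.cong (λ l → A l j) (Fin.opposite-involutive i′) ⟨
          A (opposite (opposite i′)) j  ∎)
    ; triangular  = λ A A≈0 → trans
        (det-lower-antitriangular _ λ i j <n → A≈0 (opposite j) i (1+i+j<n⇒i<opposite-j i j <n))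
        (*-congˡ (Product.sum-cong-≋ λ i → reflexive (≡.cong (λ l → A l i) (Fin.opposite-involutive i))))
    }

  -- Schröder path counts and the change of starting points

  -- Generating function of the Schröder paths that start at height y, end at
  -- height 0 and have s up or level steps.
  module Schröder (b c : ℕ → Carrier) where

    g : ℕ → ℕ → Carrier
    g zero    zero    = 1#
    g zero    (suc y) = b (suc y) * g zero y
    g (suc s) zero    = g s 1 + c 0 * g s 0
    g (suc s) (suc y) = g s (suc (suc y)) + b (suc y) * g (suc s) y + c (suc y) * g s (suc y)

    -- γ t u y counts the paths from (2u - y , y) to (2t , 0); it is g (t - u) y, and 0 if t < u.
    γ : ℕ → ℕ → ℕ → Carrier
    γ t       zero    y = g t y
    γ zero    (suc u) y = 0#
    γ (suc t) (suc u) y = γ t u y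

    γ-zero : ∀ {t u} y → t ℕ.< u → γ t u y ≈ 0#
    γ-zero {zero}  {suc u} y t<u       = refl
    γ-zero {suc t} {suc u} y (s≤s t<u) = γ-zero y t<u

    γ-diagonal : ∀ t y → γ t t y ≡ g 0 y
    γ-diagonal zero    y = ≡.refl
    γ-diagonal (suc t) y = γ-diagonal t y

    -- At `u = t` the left side counts the empty path, which has no first step; hence the strict
    -- bound.
    γ-step-0 : ∀ {t u} → u ℕ.< t → γ t u 0 ≈ γ t (suc u) 1 + c 0 * γ t (suc u) 0
    γ-step-0 {suc t} {zero}  _         = refl
    γ-step-0 {suc t} {suc u} (s≤s u<t) = γ-step-0 u<t

    -- From positive height a path to the axis is never empty, so this holds for all `u`; at `u = t`
    -- only the down step contributes.
    γ-step-suc : ∀ t u y → γ t u (suc y) ≈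
      γ t (suc u) (suc (suc y)) + b (suc y) * γ t u y + c (suc y) * γ t (suc u) (suc y)
    γ-step-suc zero zero y = sym (trans (+-cong (+-identityˡ _) (zeroʳ _)) (+-identityʳ _))
    γ-step-suc (suc t) zero y = refl
    γ-step-suc zero (suc u) y = sym (trans (+-cong (trans (+-identityˡ _) (zeroʳ _)) (zeroʳ _)) (+-identityʳ _))
    γ-step-suc (suc t) (suc u) y = γ-step-suc t u y

    -- By induction along the recursion of g, the argument belonging to the point
    -- (-2k,0) agrees with the one of (-k,k) modulo those of (-i,i) with i < k.
    module Triangular {n} (D : AlternatingForm n) (m : ℕ) where
      open AlternatingForm D

      module _ (A : Matrix n) (p : Fin n)
               (A-below : ∀ q → toℕ q ℕ.< toℕ p → ∀ j → A q j ≈ g (m ℕ.+ toℕ j) (toℕ q)) where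

        L : (Fin n → Carrier) → Carrier
        L = replace A p

        private
          at : ∀ v j → updateAt A p (const v) p j ≈ v j
          at v j = reflexive (≡.cong-app (updateAt-updates p A) j)
          off : ∀ v i → i ≢ p → ∀ j → updateAt A p (const v) i j ≈ A i j
          off v i i≢p j = reflexive (≡.cong-app (updateAt-minimal i p A i≢p) j)

        column : ℕ → ℕ → Fin n → Carrier
        column s y j = g (s ℕ.+ toℕ j) y

        -- Argument `p` then repeats an argument of smaller index.
        L-below : ∀ y → y ℕ.< toℕ p → L (column m y) ≈ 0#
        L-below y y<p = alternating q p _ q≢p λ j → trans (off _ q q≢p j)
          (trans (A-below q (≡.subst (ℕ._< toℕ p) (≡.sym q≡y) y<p) j)
                 (trans (reflexive (≡.cong (g (m ℕ.+ toℕ j)) q≡y)) (sym (at _ j))))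
          where
          q : Fin n
          q = fromℕ< (ℕ.<-trans y<p (Fin.toℕ<n p))
          q≡y : toℕ q ≡ y
          q≡y = Fin.toℕ-fromℕ< _
          q≢p : q ≢ p
          q≢p q≡p = ℕ.<⇒≢ y<p (≡.trans (≡.sym q≡y) (≡.cong toℕ q≡p))

        -- An up step preserves `y + e`, while a level or down step lowers it by one and so leads to
        -- a value that vanishes by `L-below`. Only the term of `e` successive up steps survives.
        L-shift : ∀ e y → y ℕ.+ e ℕ.≤ toℕ p → L (column (m ℕ.+ e) y) ≈ L (column m (y ℕ.+ e))
        L-shift-below : ∀ e y → y ℕ.+ e ℕ.< toℕ p → L (column (m ℕ.+ e) y) ≈ 0#

        L-shift zero y _ = form-cong λ i j → reflexive (≡.cong₂ (λ s y′ → updateAt A p (const (column s y′)) i j)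
          (ℕ.+-identityʳ m) (≡.sym (ℕ.+-identityʳ y)))
        L-shift (suc e) zero ≤p = begin
          L (column (m ℕ.+ suc e) 0)
            ≈⟨ replace-linear A p (c 0) (column (m ℕ.+ e) 0) (column (m ℕ.+ e) 1) _
                 (λ j → trans (reflexive (≡.cong (λ s → g (s ℕ.+ toℕ j) 0) (ℕ.+-suc m e))) (+-comm _ _)) ⟩
          c 0 * L (column (m ℕ.+ e) 0) + L (column (m ℕ.+ e) 1)
            ≈⟨ +-cong (trans (*-congˡ (L-shift-below e 0 ≤p)) (zeroʳ _)) (L-shift e 1 ≤p) ⟩
          0# + L (column m (suc e))
            ≈⟨ +-identityˡ _ ⟩
          L (column m (suc e)) ∎
        L-shift (suc e) (suc y) ≤p = begin
          L (column (m ℕ.+ suc e) (suc y))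
            ≈⟨ replace-linear A p (c (suc y)) (column (m ℕ.+ e) (suc y)) w _
                 (λ j → trans (reflexive (≡.cong (λ s → g (s ℕ.+ toℕ j) (suc y)) (ℕ.+-suc m e))) (+-comm _ _)) ⟩
          c (suc y) * L (column (m ℕ.+ e) (suc y)) + L w
            ≈⟨ +-congˡ (replace-linear A p (b (suc y)) (column (m ℕ.+ suc e) y) (column (m ℕ.+ e) (suc (suc y))) w
                 (λ j → trans (+-comm _ _) (+-congʳ (*-congˡ (reflexive (≡.cong (λ s → g (s ℕ.+ toℕ j) y) (≡.sym (ℕ.+-suc m e)))))))) ⟩
          c (suc y) * L (column (m ℕ.+ e) (suc y)) + (b (suc y) * L (column (m ℕ.+ suc e) y) + L (column (m ℕ.+ e) (suc (suc y))))
            ≈⟨ +-cong (trans (*-congˡ (L-shift-below e (suc y) ≤p′)) (zeroʳ _))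
                 (+-cong (trans (*-congˡ (L-shift-below (suc e) y ≤p)) (zeroʳ _)) (L-shift e (suc (suc y)) ≤p″)) ⟩
          0# + (0# + L (column m (suc (suc y) ℕ.+ e)))
            ≈⟨ trans (+-identityˡ _) (+-identityˡ _) ⟩
          L (column m (suc (suc y) ℕ.+ e))
            ≈⟨ form-cong (λ i j → reflexive (≡.cong (λ y′ → updateAt A p (const (column m y′)) i j) (≡.sym (ℕ.+-suc (suc y) e)))) ⟩
          L (column m (suc y ℕ.+ suc e)) ∎
          where
          w : Fin n → Carrier
          w j = g (m ℕ.+ e ℕ.+ toℕ j) (suc (suc y)) + b (suc y) * g (suc (m ℕ.+ e ℕ.+ toℕ j)) y
          ≤p″ : suc (suc y ℕ.+ e) ℕ.≤ toℕ p
          ≤p″ = ≡.subst (ℕ._≤ toℕ p) (ℕ.+-suc (suc y) e) ≤p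
          ≤p′ : suc y ℕ.+ e ℕ.< toℕ p
          ≤p′ = ≤p″
        L-shift-below e y <p = trans (L-shift e y (ℕ.<⇒≤ <p)) (L-below (y ℕ.+ e) <p)

      -- Interpolates between the Hankel matrix at `t = 0` and the starting points of `S` at
      -- `t = n`. The arguments are exchanged in increasing order because exchanging the one at `p`
      -- relies on those below `p`.
      mixed : ℕ → Matrix n
      mixed t k j with toℕ k ℕ.<? t
      ... | yes _ = g (m ℕ.+ toℕ j) (toℕ k)
      ... | no  _ = g (m ℕ.+ toℕ k ℕ.+ toℕ j) 0

      mixed-< : ∀ {t k} j → toℕ k ℕ.< t → mixed t k j ≈ g (m ℕ.+ toℕ j) (toℕ k)
      mixed-< {t} {k} j k<t with toℕ k ℕ.<? t
      ... | yes _   = refl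
      ... | no  k≮t = contradiction k<t k≮t

      mixed-≮ : ∀ {t k} j → t ℕ.≤ toℕ k → mixed t k j ≈ g (m ℕ.+ toℕ k ℕ.+ toℕ j) 0
      mixed-≮ {t} {k} j t≤k with toℕ k ℕ.<? t
      ... | yes k<t = contradiction t≤k (ℕ.<⇒≱ k<t)
      ... | no  _   = refl

      mixed-step : ∀ (p : Fin n) → form (mixed (toℕ p)) ≈ form (mixed (suc (toℕ p)))
      mixed-step p = begin
        form (mixed (toℕ p))    ≈⟨ form-cong (λ i j → sym (before i j)) ⟩
        L′ (λ j → g (m ℕ.+ toℕ p ℕ.+ toℕ j) 0) ≈⟨ L-shift (mixed (toℕ p)) p (λ q q<p j → mixed-< j q<p) (toℕ p) 0 ℕ.≤-refl ⟩
        L′ (λ j → g (m ℕ.+ toℕ j) (toℕ p))     ≈⟨ form-cong after ⟩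
        form (mixed (suc (toℕ p))) ∎
        where
        L′ : (Fin n → Carrier) → Carrier
        L′ = replace (mixed (toℕ p)) p
        before : ∀ i j → updateAt (mixed (toℕ p)) p (const (λ j → g (m ℕ.+ toℕ p ℕ.+ toℕ j) 0)) i j ≈ mixed (toℕ p) i j
        before i j with i Fin.≟ p
        ... | yes ≡.refl = trans (reflexive (≡.cong-app (updateAt-updates p (mixed (toℕ p))) j)) (sym (mixed-≮ j ℕ.≤-refl))
        ... | no i≢p     = reflexive (≡.cong-app (updateAt-minimal i p (mixed (toℕ p)) i≢p) j)
        after : ∀ i j → updateAt (mixed (toℕ p)) p (const (λ j → g (m ℕ.+ toℕ j) (toℕ p))) i j ≈ mixed (suc (toℕ p)) i j
        after i j with ℕ.<-cmp (toℕ i) (toℕ p)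
        ... | tri< i<p i≢p _ = trans (reflexive (≡.cong-app (updateAt-minimal i p (mixed (toℕ p)) (i≢p ∘ ≡.cong toℕ)) j))
                                 (trans (mixed-< j i<p) (sym (mixed-< j (ℕ.m<n⇒m<1+n i<p))))
        ... | tri> _ i≢p i>p = trans (reflexive (≡.cong-app (updateAt-minimal i p (mixed (toℕ p)) (i≢p ∘ ≡.cong toℕ)) j))
                                 (trans (mixed-≮ j (ℕ.<⇒≤ i>p)) (sym (mixed-≮ j i>p)))
        ... | tri≈ _ i≡p _ with ≡.refl ← Fin.toℕ-injective i≡p =
          trans (reflexive (≡.cong-app (updateAt-updates p (mixed (toℕ p))) j)) (sym (mixed-< j (ℕ.n<1+n _)))

      mixed-steps : ∀ t → t ℕ.≤ n → form (mixed 0) ≈ form (mixed t)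
      mixed-steps zero    _   = refl
      mixed-steps (suc t) t<n = trans (mixed-steps t (ℕ.<⇒≤ t<n))
        (≡.subst (λ u → form (mixed u) ≈ form (mixed (suc u))) (Fin.toℕ-fromℕ< t<n) (mixed-step (fromℕ< t<n)))

      hankel-columns : form (λ k j → g (m ℕ.+ toℕ k ℕ.+ toℕ j) 0) ≈ form (λ k j → γ (m ℕ.+ toℕ j) 0 (toℕ k))
      hankel-columns = begin
        form (λ k j → g (m ℕ.+ toℕ k ℕ.+ toℕ j) 0)   ≈⟨ form-cong (λ k j → sym (mixed-≮ j z≤n)) ⟩
        form (mixed 0)                               ≈⟨ mixed-steps n ℕ.≤-refl ⟩
        form (mixed n)                               ≈⟨ form-cong (λ k j → mixed-< j (Fin.toℕ<n k)) ⟩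
        form (λ k j → γ (m ℕ.+ toℕ j) 0 (toℕ k))     ∎

  -- Sums over lists of paths

  ∑ᴸ : ∀ {A : Set} → List A → (A → Carrier) → Carrier
  ∑ᴸ xs f = List.foldr _+_ 0# (List.map f xs)

  ∑ᴸ-cong : ∀ {A : Set} (xs : List A) {f f′} → (∀ {x} → x ∈ xs → f x ≈ f′ x) → ∑ᴸ xs f ≈ ∑ᴸ xs f′
  ∑ᴸ-cong []       eq = refl
  ∑ᴸ-cong (x ∷ xs) eq = +-cong (eq (here ≡.refl)) (∑ᴸ-cong xs (eq ∘ there))

  ∑ᴸ-zero : ∀ {A : Set} (xs : List A) → ∑ᴸ xs (λ _ → 0#) ≈ 0#
  ∑ᴸ-zero []       = refl
  ∑ᴸ-zero (x ∷ xs) = trans (+-identityˡ _) (∑ᴸ-zero xs)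

  ∑ᴸ-scale : ∀ {A : Set} (xs : List A) x f → ∑ᴸ xs (λ y → x * f y) ≈ x * ∑ᴸ xs f
  ∑ᴸ-scale []       x f = sym (zeroʳ x)
  ∑ᴸ-scale (y ∷ ys) x f = trans (+-congˡ (∑ᴸ-scale ys x f)) (sym (distribˡ x _ _))

  ∑ᴸ-++ : ∀ {A : Set} (xs ys : List A) f → ∑ᴸ (xs ++ ys) f ≈ ∑ᴸ xs f + ∑ᴸ ys f
  ∑ᴸ-++ []       ys f = sym (+-identityˡ _)
  ∑ᴸ-++ (x ∷ xs) ys f = trans (+-congˡ (∑ᴸ-++ xs ys f)) (sym (+-assoc _ _ _))

  ∑ᴸ-map : ∀ {A B : Set} (xs : List B) (h : B → A) f → ∑ᴸ (List.map h xs) f ≈ ∑ᴸ xs (f ∘ h)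
  ∑ᴸ-map xs h f = reflexive (≡.cong (List.foldr _+_ 0#) (≡.sym (List.map-∘ xs)))

  ∑ᴸ-+ : ∀ {A : Set} (xs : List A) f h → ∑ᴸ xs (λ x → f x + h x) ≈ ∑ᴸ xs f + ∑ᴸ xs h
  ∑ᴸ-+ []       f h = sym (+-identityˡ _)
  ∑ᴸ-+ (x ∷ xs) f h = trans (+-congˡ (∑ᴸ-+ xs f h))
    (solve 4 (λ p q r s → p :+ q :+ (r :+ s) := p :+ r :+ (q :+ s)) refl _ _ _ _)

  ∑ᴸ-swap : ∀ {A B : Set} (xs : List A) (ys : List B) (f : A → B → Carrier) →
            ∑ᴸ xs (λ x → ∑ᴸ ys (f x)) ≈ ∑ᴸ ys (λ y → ∑ᴸ xs (λ x → f x y))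
  ∑ᴸ-swap []       ys f = sym (∑ᴸ-zero ys)
  ∑ᴸ-swap (x ∷ xs) ys f = trans (+-congˡ (∑ᴸ-swap xs ys f)) (sym (∑ᴸ-+ ys _ _))

  restrict : ∀ {P : Set} → Dec P → Carrier → Carrier
  restrict P? x = if does P? then x else 0#

  restrict-no : ∀ {P : Set} (P? : Dec P) {x} → ¬ P → restrict P? x ≈ 0#
  restrict-no (yes p) ¬p = contradiction p ¬p
  restrict-no (no _)  ¬p = refl

  restrict-yes : ∀ {P : Set} (P? : Dec P) {x} → P → restrict P? x ≈ x
  restrict-yes (yes _) p = refl
  restrict-yes (no ¬p) p = contradiction p ¬p

  restrict-scale : ∀ {P Q : Set} (P? : Dec P) (Q? : Dec Q) {x y α} → (P → Q) → (Q → P) →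
                   x ≈ α * y → restrict P? x ≈ α * restrict Q? y
  restrict-scale (yes p) Q? P→Q Q→P eq = trans eq (*-congˡ (sym (restrict-yes Q? (P→Q p))))
  restrict-scale (no ¬p) Q? P→Q Q→P eq = sym (trans (*-congˡ (restrict-no Q? (¬p ∘ Q→P))) (zeroʳ _))

  ∑ᴸ-filter : ∀ {A : Set} {P : Pred A _} (P? : Decidable P) xs f →
              ∑ᴸ (filter P? xs) f ≈ ∑ᴸ xs (λ x → restrict (P? x) (f x))
  ∑ᴸ-filter P? []       f = refl
  ∑ᴸ-filter P? (x ∷ xs) f with P? x
  ... | yes _ = +-congˡ (∑ᴸ-filter P? xs f)
  ... | no  _ = trans (∑ᴸ-filter P? xs f) (sym (+-identityˡ _))

  module _ {A : Set} where

    ∑ᶜ : ∀ {n} → (Fin n → List A) → (Vec A n → Carrier) → Carrier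
    ∑ᶜ L f = ∑ᴸ (choices L) f

    ∑ᶜ-suc : ∀ {n} (L : Fin (suc n) → List A) f →
             ∑ᶜ L f ≈ ∑ᴸ (L zero) (λ x → ∑ᶜ (L ∘ suc) (λ v → f (x ∷ v)))
    ∑ᶜ-suc L f = product-list (L zero)
      where
      product-list : ∀ xs → ∑ᴸ (cartesianProductWith _∷_ xs (choices (L ∘ suc))) f ≈
                     ∑ᴸ xs (λ x → ∑ᶜ (L ∘ suc) (λ v → f (x ∷ v)))
      product-list []       = refl
      product-list (x ∷ xs) = trans (∑ᴸ-++ (List.map (x ∷_) (choices (L ∘ suc))) _ f)
        (+-cong (∑ᴸ-map (choices (L ∘ suc)) (x ∷_) f) (product-list xs))

    ∈-choices⁻ : ∀ {n} (L : Fin n → List A) {v} → v ∈ choices L → ∀ k → lookup v k ∈ L k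
    ∈-choices⁻ {suc n} L v∈ k with ∈-cartesianProductWith⁻ _∷_ (L zero) (choices (L ∘ suc)) v∈
    ∈-choices⁻ {suc n} L v∈ zero    | x , w , x∈ , w∈ , ≡.refl = x∈
    ∈-choices⁻ {suc n} L v∈ (suc k) | x , w , x∈ , w∈ , ≡.refl = ∈-choices⁻ (L ∘ suc) w∈ k

    ∑ᶜ-cong : ∀ {n} (L : Fin n → List A) {f f′} → (∀ v → (∀ k → lookup v k ∈ L k) → f v ≈ f′ v) →
              ∑ᶜ L f ≈ ∑ᶜ L f′
    ∑ᶜ-cong L eq = ∑ᴸ-cong (choices L) (λ v∈ → eq _ (∈-choices⁻ L v∈))

    ∑ᶜ-zero : ∀ {n} (L : Fin n → List A) {f} → (∀ v → (∀ k → lookup v k ∈ L k) → f v ≈ 0#) → ∑ᶜ L f ≈ 0#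
    ∑ᶜ-zero L eq = trans (∑ᶜ-cong L eq) (∑ᴸ-zero (choices L))

    choices-cong : ∀ {n} {L L′ : Fin n → List A} → (∀ k → L k ≡ L′ k) → choices L ≡ choices L′
    choices-cong {zero}  eq = ≡.refl
    choices-cong {suc n} eq = ≡.cong₂ (cartesianProductWith _∷_) (eq zero) (choices-cong (eq ∘ suc))

    _[_]≔[_] : ∀ {n} → (Fin n → List A) → Fin n → A → Fin n → List A
    L [ k ]≔[ x ] = updateAt L k (const (x ∷ []))

    -- Summation over coordinate `k` is moved outside. The coordinate stays in the tuple as a
    -- one-element list, so that neither the length nor the indices change.
    ∑ᶜ-at : ∀ {n} (L : Fin n → List A) k f → ∑ᶜ L f ≈ ∑ᴸ (L k) (λ x → ∑ᶜ (L [ k ]≔[ x ]) f)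
    ∑ᶜ-at L zero f = trans (∑ᶜ-suc L f)
      (∑ᴸ-cong (L zero) λ {x} _ → sym (trans (∑ᶜ-suc (L [ zero ]≔[ x ]) f) (+-identityʳ _)))
    ∑ᶜ-at L (suc k) f = begin
      ∑ᶜ L f
        ≈⟨ ∑ᶜ-suc L f ⟩
      ∑ᴸ (L zero) (λ y → ∑ᶜ (L ∘ suc) (λ v → f (y ∷ v)))
        ≈⟨ ∑ᴸ-cong (L zero) (λ {y} _ → ∑ᶜ-at (L ∘ suc) k (λ v → f (y ∷ v))) ⟩
      ∑ᴸ (L zero) (λ y → ∑ᴸ (L (suc k)) (λ x → ∑ᶜ ((L ∘ suc) [ k ]≔[ x ]) (λ v → f (y ∷ v))))
        ≈⟨ ∑ᴸ-swap (L zero) (L (suc k)) _ ⟩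
      ∑ᴸ (L (suc k)) (λ x → ∑ᴸ (L zero) (λ y → ∑ᶜ ((L ∘ suc) [ k ]≔[ x ]) (λ v → f (y ∷ v))))
        ≈⟨ ∑ᴸ-cong (L (suc k)) (λ {x} _ → sym (∑ᶜ-suc (L [ suc k ]≔[ x ]) f)) ⟩
      ∑ᴸ (L (suc k)) (λ x → ∑ᶜ (L [ suc k ]≔[ x ]) f) ∎

    -- A pinned coordinate leaves no choice, so its value may be moved from the list into the
    -- summand. This lets sums over a path and over its tail run over the same tuples.
    ∑ᶜ-pin : ∀ {n} (L : Fin n → List A) k x x′ f →
             ∑ᶜ (L [ k ]≔[ x ]) f ≈ ∑ᶜ (L [ k ]≔[ x′ ]) (λ v → f (v [ k ]≔ x))
    ∑ᶜ-pin L zero x x′ f = trans (∑ᶜ-suc (L [ zero ]≔[ x ]) f)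
      (sym (∑ᶜ-suc (L [ zero ]≔[ x′ ]) (λ v → f (v [ zero ]≔ x))))
    ∑ᶜ-pin L (suc k) x x′ f = begin
      ∑ᶜ (L [ suc k ]≔[ x ]) f
        ≈⟨ ∑ᶜ-suc (L [ suc k ]≔[ x ]) f ⟩
      ∑ᴸ (L zero) (λ y → ∑ᶜ ((L ∘ suc) [ k ]≔[ x ]) (λ v → f (y ∷ v)))
        ≈⟨ ∑ᴸ-cong (L zero) (λ {y} _ → ∑ᶜ-pin (L ∘ suc) k x x′ (λ v → f (y ∷ v))) ⟩
      ∑ᴸ (L zero) (λ y → ∑ᶜ ((L ∘ suc) [ k ]≔[ x′ ]) (λ v → f (y ∷ (v [ k ]≔ x))))
        ≈⟨ ∑ᶜ-suc (L [ suc k ]≔[ x′ ]) (λ v → f (v [ suc k ]≔ x)) ⟨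
      ∑ᶜ (L [ suc k ]≔[ x′ ]) (λ v → f (v [ suc k ]≔ x)) ∎

  ∑ᴸ-words : ∀ l f → ∑ᴸ (wordsᶻ l) f ≈
    ∑ᴸ (emptyWords l) f + (∑ᴸ (wordsᶻ (l ℤ.- 1ℤ)) (f ∘ (up ∷_)) +
      (∑ᴸ (wordsᶻ (l ℤ.- 1ℤ)) (f ∘ (down ∷_)) + ∑ᴸ (wordsᶻ (l ℤ.- + 2)) (f ∘ (level ∷_))))
  ∑ᴸ-words (+ zero) f = solve 1 (λ x → x :+ con 0 := x :+ con 0 :+ (con 0 :+ (con 0 :+ con 0))) refl _
  ∑ᴸ-words (+ suc zero) f = solve 2 (λ x y → x :+ (y :+ con 0) := con 0 :+ (x :+ con 0 :+ (y :+ con 0 :+ con 0))) refl _ _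
  ∑ᴸ-words (+ suc (suc l)) f = trans
    (trans (∑ᴸ-++ (List.map (up ∷_) (wordsOfWidth (suc l))) _ f)
      (+-cong (∑ᴸ-map (wordsOfWidth (suc l)) (up ∷_) f)
        (trans (∑ᴸ-++ (List.map (down ∷_) (wordsOfWidth (suc l))) _ f)
          (+-cong (∑ᴸ-map (wordsOfWidth (suc l)) (down ∷_) f) (∑ᴸ-map (wordsOfWidth l) (level ∷_) f)))))
    (sym (+-identityˡ _))
  ∑ᴸ-words -[1+ n ] f = solve 0 (con 0 := con 0 :+ (con 0 :+ (con 0 :+ con 0))) refl

  product-scale-at : ∀ {n} (k : Fin n) α (f f′ : Fin n → Carrier) → f k ≈ α * f′ k →
                     (∀ i → i ≢ k → f i ≈ f′ i) → product f ≈ α * product f′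
  product-scale-at {suc n} k α f f′ eq eqs = begin
    product f                                ≈⟨ Product.sum-remove {i = k} f ⟩
    f k * product (f ∘ punchIn k)            ≈⟨ *-cong eq (Product.sum-cong-≋ λ i → eqs _ (Fin.punchInᵢ≢i k i)) ⟩
    α * f′ k * product (f′ ∘ punchIn k)      ≈⟨ *-assoc _ _ _ ⟩
    α * (f′ k * product (f′ ∘ punchIn k))    ≈⟨ *-congˡ (Product.sum-remove {i = k} f′) ⟨
    α * product f′                           ∎

  -- Recursion for the weighted sums of admissible tuples

  module Paths (b c : ℕ → Carrier) (m n : ℕ) where

    candidates : (Fin n → State) → Fin n → List Path
    candidates a k = List.map (path (pt (a k))) (wordsᶻ (proj₁ (endPoint m k) ℤ.- proj₁ (pt (a k))))

    term : Vec Path n → Carrier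
    term v = restrict (admissible? m n (lookup v)) (tupleWeight b c v)

    N : (Fin n → State) → Carrier
    N a = ∑ᶜ (candidates a) term

    term-zero : ∀ v → ¬ Admissible m n (lookup v) → term v ≈ 0#
    term-zero v = restrict-no (admissible? m n (lookup v))

    ∈-candidates : ∀ a k {P} → P ∈ candidates a k → ∃ λ ts → P ≡ path (pt (a k)) ts
    ∈-candidates a k P∈ with ts , _ , eq ← ∈-map⁻ _ P∈ = ts , eq

    N-collision : ∀ a i j → i ≢ j → a i ≡ a j → N a ≈ 0#
    N-collision a i j i≢j ai≡aj = ∑ᶜ-zero (candidates a) λ v v∈ → term-zero v λ s →
      Admissible.nonIntersecting s i j i≢j
        (starts-at v v∈ i , ≡.subst (λ p → pt p ∈ vertices (lookup v j)) (≡.sym ai≡aj) (starts-at v v∈ j))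
      where
      starts-at : ∀ v → (∀ k → lookup v k ∈ candidates a k) → ∀ k → pt (a k) ∈ vertices (lookup v k)
      starts-at v v∈ k with ts , eq ← ∈-candidates a k (v∈ k) =
        ≡.subst (λ R → pt (a k) ∈ vertices R) (≡.sym eq) (start∈vertices _ ts)

    N-beyond : ∀ a k → m ℕ.+ toℕ k ℕ.< proj₁ (a k) → N a ≈ 0#
    N-beyond a k m+k<u = ∑ᶜ-zero (candidates a) λ v v∈ → term-zero v (impossible v (∈-candidates a k (v∈ k)))
      where
      impossible : ∀ v → (∃ λ ts → lookup v k ≡ path (pt (a k)) ts) → ¬ Admissible m n (lookup v)
      impossible v (ts , eq) s = ℕ.<⇒≱ m+k<u (proj₁ (reachable ts
        (≡.subst (_∈ verticesFrom (pt (a k)) ts) (≡.trans (≡.sym (≡.cong end eq)) (Admissible.ends s k)) (end∈vertices _ ts))))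

    N-finished : ∀ a → (∀ k → a k ≡ (m ℕ.+ toℕ k , toℕ k)) → N a ≈ 1#
    N-finished a a≡ = begin
      N a
        ≡⟨ ≡.cong (λ vs → ∑ᴸ vs term) (choices-cong only) ⟩
      ∑ᶜ (λ k → path (endPoint m k) [] ∷ []) term
        ≡⟨ ≡.cong (λ vs → ∑ᴸ vs term) (choices-singleton (λ k → path (endPoint m k) [])) ⟩
      term (Vec.tabulate λ k → path (endPoint m k) []) + 0#
        ≈⟨ +-identityʳ _ ⟩
      term (Vec.tabulate λ k → path (endPoint m k) [])
        ≈⟨ restrict-yes (admissible? m n _) good ⟩
      tupleWeight b c {n} (Vec.tabulate λ k → path (endPoint m k) [])
        ≈⟨ Product.sum-cong-≋ {n} (λ k → reflexive (≡.cong (weight b c) (Vec.lookup∘tabulate (λ k → path (endPoint m k) []) k))) ⟩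
      product {n} (λ _ → 1#)
        ≈⟨ Product.sum-replicate-zero n ⟩
      1# ∎
      where
      only : ∀ k → candidates a k ≡ path (endPoint m k) [] ∷ []
      only k = ≡.trans (≡.cong (λ s → List.map (path (pt s)) (wordsᶻ (proj₁ (endPoint m k) ℤ.- proj₁ (pt s)))) (a≡ k))
        (≡.cong (λ l → List.map (path (endPoint m k)) (wordsᶻ l)) (ℤ.+-inverseʳ (proj₁ (endPoint m k))))
      choices-singleton : ∀ {A : Set} {n} (x : Fin n → A) → choices (λ k → x k ∷ []) ≡ Vec.tabulate x ∷ []
      choices-singleton {n = zero}  x = ≡.refl
      choices-singleton {n = suc n} x rewrite choices-singleton (x ∘ suc) = ≡.refl
      good : Admissible m n (lookup (Vec.tabulate λ k → path (endPoint m k) []))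
      good = admissible
        (λ k → ≡.subst IsSchröder (≡.sym (at k)) (ℤ.+≤+ z≤n ∷ []))
        (λ k → ≡.cong end (at k))
        (λ i j i≢j (q∈ , q∈′) → disjoint i j i≢j
          (≡.subst (λ R → _ ∈ vertices R) (at i) q∈) (≡.subst (λ R → _ ∈ vertices R) (at j) q∈′))
        where
        at : ∀ k → lookup (Vec.tabulate λ k → path (endPoint m k) []) k ≡ path (endPoint m k) []
        at = Vec.lookup∘tabulate (λ k → path (endPoint m k) [])
        disjoint : ∀ (i j : Fin n) → i ≢ j → ∀ {q} → q ∈ endPoint m i ∷ [] → ¬ (q ∈ endPoint m j ∷ [])
        disjoint i j i≢j (here q≡i) (here q≡j) =
          i≢j (Fin.toℕ-injective (ℤ.+-injective (≡.cong proj₂ (≡.trans (≡.sym q≡i) q≡j))))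

    _[_]≔ˢ_ : (Fin n → State) → Fin n → State → Fin n → State
    a [ k ]≔ˢ s = updateAt a k (const s)

    -- By `u<m+y` path `k` starts before the line `x - y = 2m` of the end points and so has a first
    -- step. By `separated` every other starting point exceeds this one in a coordinate that never
    -- decreases along a path, so no other path meets it and the first step can be removed.
    module _ (a : Fin n → State) (k : Fin n) (u y : ℕ) (ak : a k ≡ (u , y)) (u<m+y : u ℕ.< m ℕ.+ y)
             (separated : ∀ i → i ≢ k → u ℕ.< proj₁ (a i) ⊎ u ℕ.+ proj₂ (a i) ℕ.< proj₁ (a i) ℕ.+ y) where

      private
        p : Point
        p = pt (u , y)

        width-from : Point → ℤ
        width-from q = proj₁ (endPoint m k) ℤ.- proj₁ q

        pinned : Path → Carrier
        pinned P = ∑ᶜ (candidates a [ k ]≔[ P ]) term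

        avoid : ∀ i → i ≢ k → ∀ ts → p ∉ verticesFrom (pt (a i)) ts
        avoid i i≢k ts p∈ with reachable ts p∈ | separated i i≢k
        ... | r , _ | inj₁ s = ℕ.<⇒≱ s r
        ... | _ , r | inj₂ s = ℕ.<⇒≱ s r

        member-at : ∀ {P} (v : Vec Path n) → (∀ i → lookup v i ∈ (candidates a [ k ]≔[ P ]) i) → lookup v k ≡ P
        member-at v v∈ with here eq ← ≡.subst (_ ∈_) (updateAt-updates k (candidates a)) (v∈ k) = eq

        pinned-zero : ∀ P → (∀ v → lookup v k ≡ P → ¬ Admissible m n (lookup v)) → pinned P ≈ 0#
        pinned-zero P bad = ∑ᶜ-zero (candidates a [ k ]≔[ P ]) λ v v∈ → term-zero v (bad v (member-at v v∈))

        split : ∑ᶜ (candidates a) term ≈ ∑ᴸ (wordsᶻ (width-from p)) (λ ts → pinned (path p ts))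
        split = begin
          ∑ᶜ (candidates a) term
            ≈⟨ ∑ᶜ-at (candidates a) k term ⟩
          ∑ᴸ (candidates a k) pinned
            ≈⟨ ∑ᴸ-map (wordsᶻ (width-from (pt (a k)))) (path (pt (a k))) pinned ⟩
          ∑ᴸ (wordsᶻ (width-from (pt (a k)))) (λ ts → pinned (path (pt (a k)) ts))
            ≡⟨ ≡.cong (λ s → ∑ᴸ (wordsᶻ (width-from (pt s))) (λ ts → pinned (path (pt s) ts))) ak ⟩
          ∑ᴸ (wordsᶻ (width-from p)) (λ ts → pinned (path p ts)) ∎

        advance : ∀ t s → move t p ≡ pt s → ∀ l → l ≡ width-from (pt s) →
          ∑ᴸ (wordsᶻ l) (λ ts → pinned (path p (t ∷ ts))) ≈ label b c t p * N (a [ k ]≔ˢ s)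
        advance t s tp≡ l ≡.refl = begin
          ∑ᴸ (wordsᶻ l) (λ ts → pinned (path p (t ∷ ts)))
            ≈⟨ ∑ᴸ-cong (wordsᶻ l) (λ {ts} _ → shorten ts) ⟩
          ∑ᴸ (wordsᶻ l) (λ ts → label b c t p * ∑ᶜ (candidates a′ [ k ]≔[ path (pt s) ts ]) term)
            ≈⟨ ∑ᴸ-scale (wordsᶻ l) _ _ ⟩
          label b c t p * ∑ᴸ (wordsᶻ l) (λ ts → ∑ᶜ (candidates a′ [ k ]≔[ path (pt s) ts ]) term)
            ≈⟨ *-congˡ split′ ⟨
          label b c t p * N a′ ∎
          where
          a′ : Fin n → State
          a′ = a [ k ]≔ˢ s
          split′ : N a′ ≈ ∑ᴸ (wordsᶻ l) (λ ts → ∑ᶜ (candidates a′ [ k ]≔[ path (pt s) ts ]) term)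
          split′ = begin
            N a′
              ≈⟨ ∑ᶜ-at (candidates a′) k term ⟩
            ∑ᴸ (candidates a′ k) (λ P → ∑ᶜ (candidates a′ [ k ]≔[ P ]) term)
              ≡⟨ ≡.cong (λ s → ∑ᴸ (List.map (path (pt s)) (wordsᶻ (width-from (pt s)))) (λ P → ∑ᶜ (candidates a′ [ k ]≔[ P ]) term))
                   (updateAt-updates k a) ⟩
            ∑ᴸ (List.map (path (pt s)) (wordsᶻ l)) (λ P → ∑ᶜ (candidates a′ [ k ]≔[ P ]) term)
              ≈⟨ ∑ᴸ-map (wordsᶻ l) (path (pt s)) _ ⟩
            ∑ᴸ (wordsᶻ l) (λ ts → ∑ᶜ (candidates a′ [ k ]≔[ path (pt s) ts ]) term) ∎
          shorten : ∀ ts → pinned (path p (t ∷ ts)) ≈ label b c t p * ∑ᶜ (candidates a′ [ k ]≔[ path (pt s) ts ]) term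
          shorten ts = begin
            pinned (path p (t ∷ ts))
              -- The tail is pinned and the full path is put back inside the summand, so that the
              -- two terms can be compared tuple by tuple.
              ≈⟨ ∑ᶜ-pin (candidates a) k (path p (t ∷ ts)) (path (pt s) ts) term ⟩
            ∑ᶜ (candidates a [ k ]≔[ path (pt s) ts ]) (λ v → term (v [ k ]≔ path p (t ∷ ts)))
              ≈⟨ ∑ᶜ-cong (candidates a [ k ]≔[ path (pt s) ts ]) step ⟩
            ∑ᶜ (candidates a [ k ]≔[ path (pt s) ts ]) (λ v → label b c t p * term v)
              ≈⟨ ∑ᴸ-scale (choices (candidates a [ k ]≔[ path (pt s) ts ])) _ term ⟩
            label b c t p * ∑ᶜ (candidates a [ k ]≔[ path (pt s) ts ]) term
              ≡⟨ ≡.cong (λ vs → label b c t p * ∑ᴸ vs term) (choices-cong same) ⟩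
            label b c t p * ∑ᶜ (candidates a′ [ k ]≔[ path (pt s) ts ]) term ∎
            where
            same : ∀ i → (candidates a [ k ]≔[ path (pt s) ts ]) i ≡ (candidates a′ [ k ]≔[ path (pt s) ts ]) i
            same i with i Fin.≟ k
            ... | yes ≡.refl = ≡.trans (updateAt-updates k (candidates a)) (≡.sym (updateAt-updates k (candidates a′)))
            ... | no i≢k     = ≡.trans (updateAt-minimal i k (candidates a) i≢k)
              (≡.trans (≡.cong (λ s → List.map (path (pt s)) (wordsᶻ (proj₁ (endPoint m i) ℤ.- proj₁ (pt s))))
                         (≡.sym (updateAt-minimal i k a i≢k)))
                       (≡.sym (updateAt-minimal i k (candidates a′) i≢k)))
            step : ∀ v → (∀ i → lookup v i ∈ (candidates a [ k ]≔[ path (pt s) ts ]) i) →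
                   term (v [ k ]≔ path p (t ∷ ts)) ≈ label b c t p * term v
            step v v∈ = restrict-scale (admissible? m n (lookup v′)) (admissible? m n (lookup v)) (proj₁ iff) (proj₂ iff)
              (product-scale-at k _ _ _
                (trans (reflexive (≡.cong (weight b c) at))
                  (*-congˡ (reflexive (≡.sym (≡.cong (weight b c) at′)))))
                (λ i i≢k → reflexive (≡.cong (weight b c) (off i i≢k))))
              where
              v′ : Vec Path n
              v′ = v [ k ]≔ path p (t ∷ ts)
              at : lookup v′ k ≡ path p (t ∷ ts)
              at = Vec.lookup∘updateAt k v
              at′ : lookup v k ≡ path (move t p) ts
              at′ = ≡.trans (member-at v v∈) (≡.cong (λ q → path q ts) (≡.sym tp≡))
              off : ∀ i → i ≢ k → lookup v′ i ≡ lookup v i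
              off i i≢k = Vec.lookup∘updateAt′ i k i≢k v
              iff : (Admissible m n (lookup v′) → Admissible m n (lookup v)) × (Admissible m n (lookup v) → Admissible m n (lookup v′))
              iff = admissible-step (lookup v′) (lookup v) k p t ts at at′ off (ℤ.+≤+ z≤n) λ i i≢k p∈ →
                avoid-path i i≢k (∈-candidates a i (≡.subst (lookup v i ∈_) (updateAt-minimal i k (candidates a) i≢k) (v∈ i))) p∈
                where
                avoid-path : ∀ i → i ≢ k → (∃ λ ts → lookup v i ≡ path (pt (a i)) ts) → p ∉ vertices (lookup v i)
                avoid-path i i≢k (us , eq) p∈ = avoid i i≢k us (≡.subst (λ R → p ∈ vertices R) eq p∈)

        width-shift : ∀ j q → proj₁ p ℤ.+ + j ≡ proj₁ q → width-from p ℤ.- + j ≡ width-from q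
        width-shift j q eq = ≡.trans (shuffle (proj₁ (endPoint m k)) (proj₁ p) (+ j)) (≡.cong (λ x → proj₁ (endPoint m k) ℤ.- x) eq)
          where
          shuffle : ∀ e x j → e ℤ.- x ℤ.- j ≡ e ℤ.- (x ℤ.+ j)
          shuffle = solve-∀

        stop-zero : ∑ᴸ (emptyWords (width-from p)) (λ ts → pinned (path p ts)) ≈ 0#
        stop-zero = trans (∑ᴸ-cong (emptyWords (width-from p)) λ {ts} ts∈ → stopped ts (∈-emptyWords (width-from p) ts∈))
          (∑ᴸ-zero (emptyWords (width-from p)))
          where
          stopped : ∀ ts → ts ≡ [] → pinned (path p ts) ≈ 0#
          stopped ts ≡.refl = pinned-zero (path p []) λ v eq s → not-there (≡.trans (≡.sym (≡.cong end eq)) (Admissible.ends s k))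
            where
            not-there : ¬ (p ≡ endPoint m k)
            not-there p≡ = ℕ.<-irrefl ≡.refl (ℕ.<-≤-trans u<m+y
              (≡.subst (λ h → m ℕ.+ h ℕ.≤ u) (≡.sym y≡k)
                (proj₁ (reachable {m ℕ.+ toℕ k} {toℕ k} {u} {y} [] (here p≡)))))
              where
              y≡k : y ≡ toℕ k
              y≡k = ℤ.+-injective (≡.cong proj₂ p≡)

        -- Left unevaluated here: on the axis it vanishes because the path would go below it, and at
        -- positive height `advance` applies.
        down-step : Carrier
        down-step = ∑ᴸ (wordsᶻ (width-from p ℤ.- 1ℤ)) (λ ts → pinned (path p (down ∷ ts)))

        N-expand : N a ≈ N (a [ k ]≔ˢ (suc u , suc y)) + (down-step + c y * N (a [ k ]≔ˢ (suc u , y)))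
        N-expand = begin
          N a
            ≈⟨ split ⟩
          ∑ᴸ (wordsᶻ (width-from p)) (λ ts → pinned (path p ts))
            ≈⟨ ∑ᴸ-words (width-from p) (λ ts → pinned (path p ts)) ⟩
          _
            ≈⟨ +-cong stop-zero (+-cong
                 (trans (advance up (suc u , suc y) (pt-up u y) _ (width-shift 1 (pt (suc u , suc y)) (≡.cong proj₁ (pt-up u y)))) (*-identityˡ _))
                 (+-congˡ (advance level (suc u , y) (pt-level u y) _ (width-shift 2 (pt (suc u , y)) (≡.cong proj₁ (pt-level u y)))))) ⟩
          0# + (N (a [ k ]≔ˢ (suc u , suc y)) + (down-step + c y * N (a [ k ]≔ˢ (suc u , y))))
            ≈⟨ +-identityˡ _ ⟩
          N (a [ k ]≔ˢ (suc u , suc y)) + (down-step + c y * N (a [ k ]≔ˢ (suc u , y))) ∎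

      N-step-0 : y ≡ 0 → N a ≈ N (a [ k ]≔ˢ (suc u , suc y)) + c y * N (a [ k ]≔ˢ (suc u , y))
      N-step-0 y≡0 = trans N-expand (+-congˡ (trans (+-congʳ no-down) (+-identityˡ _)))
        where
        no-down : down-step ≈ 0#
        no-down = trans (∑ᴸ-cong (wordsᶻ (width-from p ℤ.- 1ℤ)) λ {ts} _ → pinned-zero (path p (down ∷ ts)) λ v eq s →
            negative (≡.cong (λ h → + h ℤ.- 1ℤ) y≡0) (All.lookup (Admissible.schröder s k)
              (≡.subst (λ R → move down p ∈ vertices R) (≡.sym eq) (there (start∈vertices _ ts)))))
          (∑ᴸ-zero (wordsᶻ (width-from p ℤ.- 1ℤ)))
          where
          negative : ∀ {i} → i ≡ -[1+ 0 ] → ¬ (0ℤ ℤ.≤ i)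
          negative ≡.refl ()

      N-step-suc : ∀ y′ → y ≡ suc y′ → N a ≈ N (a [ k ]≔ˢ (suc u , suc y)) +
                   (b y * N (a [ k ]≔ˢ (u , y′)) + c y * N (a [ k ]≔ˢ (suc u , y)))
      N-step-suc y′ ≡.refl = trans N-expand (+-congˡ (+-congʳ
        (advance down (u , y′) (pt-down u y′) _ (width-shift 1 (pt (u , y′)) (≡.cong proj₁ (pt-down u y′))))))

  -- Non-intersecting paths

  module LGV (b c : ℕ → Carrier) (m : ℕ) {n : ℕ} (D : AlternatingForm n) where
    open AlternatingForm D
    open Schröder b c
    open Paths b c m n

    column : State → Fin n → Carrier
    column (u , y) j = γ (m ℕ.+ toℕ j) u y

    formAt : (Fin n → State) → Carrier
    formAt a = form (column ∘ a)

    -- The paths of the determinant end at `(2m + 2j , 0)`, those of `N` at `(2m + j , j)`; `g 0 j`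
    -- is the weight of the descent between the two.
    factor : Carrier
    factor = reversalSign n * product {n} (λ j → g 0 (toℕ j))

    -- Planarity: the paths are listed from the lowest to the highest.
    record Ordered (a : Fin n → State) : Set where
      field
        before-end : ∀ k → proj₁ (a k) ℕ.≤ m ℕ.+ proj₂ (a k)
        u-mono     : ∀ i j → toℕ i ℕ.< toℕ j → proj₁ (a i) ℕ.≤ proj₁ (a j)
        w-mono     : ∀ i j → toℕ i ℕ.< toℕ j → a j ≤ʷ a i

    -- An up step lowers only the first summand, a down step only the second, and a level step both,
    -- as long as `u < m + n` and `u < m + y`.
    remaining : State → ℕ
    remaining (u , y) = (m ℕ.+ n ∸ u) ℕ.+ (m ℕ.+ y ∸ u)

    both-zero : ∀ a → formAt a ≈ 0# → N a ≈ 0# → formAt a ≈ factor * N a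
    both-zero a D≈0 N≈0 = trans D≈0 (sym (trans (*-congˡ N≈0) (zeroʳ _)))

    replace-formAt : ∀ a k s → replace (column ∘ a) k (column s) ≈ formAt (a [ k ]≔ˢ s)
    replace-formAt a k s = form-cong λ i j → reflexive (≡.cong-app (eq i) j)
      where
      eq : ∀ i → updateAt (column ∘ a) k (const (column s)) i ≡ column ((a [ k ]≔ˢ s) i)
      eq i with i Fin.≟ k
      ... | yes ≡.refl = ≡.trans (updateAt-updates k (column ∘ a)) (≡.cong column (≡.sym (updateAt-updates k a)))
      ... | no i≢k     = ≡.trans (updateAt-minimal i k (column ∘ a) i≢k) (≡.cong column (≡.sym (updateAt-minimal i k a i≢k)))

    formAt-replace : ∀ a k s → a k ≡ s → formAt a ≈ replace (column ∘ a) k (column s)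
    formAt-replace a k s ak≡s = form-cong λ i j → reflexive (≡.cong-app (eq i) j)
      where
      eq : ∀ i → column (a i) ≡ updateAt (column ∘ a) k (const (column s)) i
      eq i with i Fin.≟ k
      ... | yes ≡.refl = ≡.trans (≡.cong column ak≡s) (≡.sym (updateAt-updates k (column ∘ a)))
      ... | no i≢k     = ≡.sym (updateAt-minimal i k (column ∘ a) i≢k)

    formAt-step-0 : ∀ a k u → a k ≡ (u , 0) → u ℕ.< m →
      formAt a ≈ formAt (a [ k ]≔ˢ (suc u , 1)) + c 0 * formAt (a [ k ]≔ˢ (suc u , 0))
    formAt-step-0 a k u ak u<m = begin
      formAt a
        ≈⟨ formAt-replace a k (u , 0) ak ⟩
      replace (column ∘ a) k (column (u , 0))
        ≈⟨ replace-linear (column ∘ a) k (c 0) (column (suc u , 0)) (column (suc u , 1)) _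
             (λ j → trans (γ-step-0 (ℕ.<-≤-trans u<m (ℕ.m≤m+n m (toℕ j)))) (+-comm _ _)) ⟩
      c 0 * replace (column ∘ a) k (column (suc u , 0)) + replace (column ∘ a) k (column (suc u , 1))
        ≈⟨ +-cong (*-congˡ (replace-formAt a k (suc u , 0))) (replace-formAt a k (suc u , 1)) ⟩
      c 0 * formAt (a [ k ]≔ˢ (suc u , 0)) + formAt (a [ k ]≔ˢ (suc u , 1))
        ≈⟨ +-comm _ _ ⟩
      formAt (a [ k ]≔ˢ (suc u , 1)) + c 0 * formAt (a [ k ]≔ˢ (suc u , 0)) ∎

    formAt-step-suc : ∀ a k u y → a k ≡ (u , suc y) →
      formAt a ≈ formAt (a [ k ]≔ˢ (suc u , suc (suc y))) +
        (b (suc y) * formAt (a [ k ]≔ˢ (u , y)) + c (suc y) * formAt (a [ k ]≔ˢ (suc u , suc y)))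
    formAt-step-suc a k u y ak = begin
      formAt a
        ≈⟨ formAt-replace a k (u , suc y) ak ⟩
      R (column (u , suc y))
        ≈⟨ replace-linear (column ∘ a) k (c (suc y)) (column (suc u , suc y)) v _
             (λ j → trans (γ-step-suc (m ℕ.+ toℕ j) u y) (+-comm _ _)) ⟩
      c (suc y) * R (column (suc u , suc y)) + R v
        ≈⟨ +-congˡ (replace-linear (column ∘ a) k (b (suc y)) (column (u , y)) (column (suc u , suc (suc y))) v (λ j → +-comm _ _)) ⟩
      c (suc y) * R (column (suc u , suc y)) + (b (suc y) * R (column (u , y)) + R (column (suc u , suc (suc y))))
        ≈⟨ +-cong (*-congˡ (replace-formAt a k _)) (+-cong (*-congˡ (replace-formAt a k _)) (replace-formAt a k _)) ⟩
      c (suc y) * formAt (a [ k ]≔ˢ (suc u , suc y)) + (b (suc y) * formAt (a [ k ]≔ˢ (u , y)) + formAt (a [ k ]≔ˢ (suc u , suc (suc y))))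
        ≈⟨ solve 3 (λ p q r → p :+ (q :+ r) := r :+ (q :+ p)) refl _ _ _ ⟩
      formAt (a [ k ]≔ˢ (suc u , suc (suc y))) +
        (b (suc y) * formAt (a [ k ]≔ˢ (u , y)) + c (suc y) * formAt (a [ k ]≔ˢ (suc u , suc y))) ∎
      where
      R : (Fin n → Carrier) → Carrier
      R = replace (column ∘ a) k
      v : Fin n → Carrier
      v j = γ (m ℕ.+ toℕ j) (suc u) (suc (suc y)) + b (suc y) * γ (m ℕ.+ toℕ j) u y

    Collision : (Fin n → State) → Set
    Collision a = ∃ λ i → ∃ λ j → i ≢ j × a i ≡ a j

    -- With `w-mono` the assumption makes the two values of `u - y` equal, so equal values of `u`
    -- would be a collision.
    u-strict : ∀ a → Ordered a → ¬ Collision a → ∀ i j → toℕ i ℕ.< toℕ j → a i ≤ʷ a j → proj₁ (a i) ℕ.< proj₁ (a j)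
    u-strict a ord distinct i j i<j i≤ʷj = ℕ.≤∧≢⇒< (u-mono i j i<j) λ u≡ →
      distinct (i , j , (λ i≡j → ℕ.<⇒≢ i<j (≡.cong toℕ i≡j)) , ≡.cong₂ _,_ u≡ (ℕ.≤-antisym
        (ℕ.+-cancelˡ-≤ (proj₁ (a i)) _ _ (≡.subst (λ u → u ℕ.+ proj₂ (a i) ℕ.≤ proj₁ (a i) ℕ.+ proj₂ (a j)) (≡.sym u≡) (w-mono i j i<j)))
        (ℕ.+-cancelˡ-≤ (proj₁ (a i)) _ _ (≡.subst (λ u → proj₁ (a i) ℕ.+ proj₂ (a j) ℕ.≤ u ℕ.+ proj₂ (a i)) (≡.sym u≡) i≤ʷj))))
      where open Ordered ord

    -- Distinct starting points on one line have strictly increasing `u`, hence `u ≥ m + k`, and the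
    -- matrix is triangular. Either they are the end points themselves, or some `u` exceeds `m + k`:
    -- then a diagonal entry vanishes, and path `k` already starts beyond its end.
    all-finished : ∀ a → Ordered a → ¬ Collision a → (∀ k → proj₁ (a k) ≡ m ℕ.+ proj₂ (a k)) →
                   formAt a ≈ factor * N a
    all-finished a ord distinct u≡ = helper (Fin.all? λ k → proj₁ (a k) ℕ.≟ m ℕ.+ toℕ k)
      where
      bound : ∀ k → m ℕ.+ toℕ k ℕ.≤ proj₁ (a k)
      bound = increasing-bound m (proj₁ ∘ a) (λ k → ≡.subst (m ℕ.≤_) (≡.sym (u≡ k)) (ℕ.m≤m+n m _))
        (λ i j i<j → u-strict a ord distinct i j i<j (ℕ.≤-reflexive (begin-≡ i j)))
        where
        begin-≡ : ∀ i j → proj₁ (a i) ℕ.+ proj₂ (a j) ≡ proj₁ (a j) ℕ.+ proj₂ (a i)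
        begin-≡ i j rewrite u≡ i | u≡ j = ≡.trans (ℕ.+-assoc m _ _)
          (≡.trans (≡.cong (m ℕ.+_) (ℕ.+-comm (proj₂ (a i)) _)) (≡.sym (ℕ.+-assoc m _ _)))
      diagonal : formAt a ≈ reversalSign n * product (λ k → column (a k) k)
      diagonal = triangular (column ∘ a) λ i j j<i → γ-zero (proj₂ (a i)) (ℕ.<-≤-trans (ℕ.+-monoʳ-< m j<i) (bound i))
      helper : Dec (∀ k → proj₁ (a k) ≡ m ℕ.+ toℕ k) → formAt a ≈ factor * N a
      helper (yes u≡m+k) = begin
        formAt a                                             ≈⟨ diagonal ⟩
        reversalSign n * product (λ k → column (a k) k)      ≈⟨ *-congˡ (Product.sum-cong-≋ λ k → reflexive
                                                                  (≡.trans (≡.cong (λ s → column s k) (at-end k)) (γ-diagonal (m ℕ.+ toℕ k) (toℕ k)))) ⟩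
        factor                                             ≈⟨ *-identityʳ _ ⟨
        factor * 1#                                        ≈⟨ *-congˡ (N-finished a at-end) ⟨
        factor * N a                                       ∎
        where
        at-end : ∀ k → a k ≡ (m ℕ.+ toℕ k , toℕ k)
        at-end k = ≡.cong₂ _,_ (u≡m+k k) (ℕ.+-cancelˡ-≡ m _ _ (≡.trans (≡.sym (u≡ k)) (u≡m+k k)))
      helper (no ¬u≡m+k) with k , u≢ ← Fin.¬∀⟶∃¬ n _ (λ k → proj₁ (a k) ℕ.≟ m ℕ.+ toℕ k) ¬u≡m+k =
        both-zero a (trans diagonal (trans (*-congˡ (product-zero k (γ-zero (proj₂ (a k)) beyond))) (zeroʳ _)))
          (N-beyond a k beyond)
        where
        beyond : m ℕ.+ toℕ k ℕ.< proj₁ (a k)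
        beyond = ℕ.≤∧≢⇒< (bound k) (u≢ ∘ ≡.sym)
        product-zero : ∀ {n} (k : Fin n) {f : Fin n → Carrier} → f k ≈ 0# → product f ≈ 0#
        product-zero {suc n} k {f} fk≈0 = trans (Product.sum-remove {i = k} f) (trans (*-congʳ fk≈0) (zeroˡ _))

    -- The path whose next step is expanded: the one whose starting point is
    -- lexicographically least for (u - y , u). No other path can reach that point.
    record Next (a : Fin n → State) : Set where
      field
        k       : Fin n
        u<m+y   : proj₁ (a k) ℕ.< m ℕ.+ proj₂ (a k)
        lower   : ∀ i → toℕ i ℕ.< toℕ k → a k <ʷ a i
        higher  : ∀ i → toℕ k ℕ.< toℕ i → proj₁ (a k) ℕ.< proj₁ (a i)

    -- The first index with least `u - y` is taken: earlier indices have larger `u - y`, and later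
    -- ones larger `u` by `u-strict`. The unfinished index `k₀` shows that the least `u - y` is
    -- below `m`.
    next : ∀ a → Ordered a → ¬ Collision a → ¬ (∀ k → proj₁ (a k) ≡ m ℕ.+ proj₂ (a k)) → Next a
    next a ord distinct unfinished
      with k₀ , u≢ ← Fin.¬∀⟶∃¬ n _ (λ k → proj₁ (a k) ℕ.≟ m ℕ.+ proj₂ (a k)) unfinished
      with k , k-least , k-first ← least {P = λ k → ∀ i → a k ≤ʷ a i} (λ k → Fin.all? λ i → _ ℕ.≤? _) (last-least a (Ordered.w-mono ord) k₀)
      = record
      { k      = k
      ; u<m+y  = ℕ.+-cancelʳ-< (proj₂ (a k₀)) _ _ (ℕ.≤-<-trans (k-least k₀)
          (≡.subst (proj₁ (a k₀) ℕ.+ proj₂ (a k) ℕ.<_) (swap m (proj₂ (a k₀)) (proj₂ (a k)))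
            (ℕ.+-monoˡ-< (proj₂ (a k)) (ℕ.≤∧≢⇒< (before-end k₀) u≢))))
      ; lower  = λ i i<k → ℕ.≰⇒> λ i≤k → k-first i i<k λ j → ≤ʷ-trans (a i) (a k) (a j) i≤k (k-least j)
      ; higher = λ i k<i → u-strict a ord distinct k i k<i (k-least i)
      }
      where
      open Ordered ord
      swap : ∀ x y z → x ℕ.+ y ℕ.+ z ≡ x ℕ.+ z ℕ.+ y
      swap x y z = ≡.trans (ℕ.+-assoc x y z) (≡.trans (≡.cong (x ℕ.+_) (ℕ.+-comm y z)) (≡.sym (ℕ.+-assoc x z y)))

    module _ (a : Fin n → State) (ord : Ordered a) (nxt : Next a) where
      open Ordered ord
      open Next nxt

      -- A step raises `u` and `u - y` by at most one. The strict inequalities of `Next` leave room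
      -- for it: `higher` for `u`, `lower` for `u - y`, and `u<m+y` at the line of the end points.
      ordered-step : ∀ u′ y′ → proj₁ (a k) ℕ.≤ u′ → u′ ℕ.≤ suc (proj₁ (a k)) → a k ≤ʷ (u′ , y′) →
                     u′ ℕ.+ proj₂ (a k) ℕ.≤ suc (proj₁ (a k) ℕ.+ y′) → Ordered (a [ k ]≔ˢ (u′ , y′))
      ordered-step u′ y′ u≤u′ u′≤1+u w≤w′ w′≤1+w = record
        { before-end = before
        ; u-mono     = λ i j i<j → u-mono′ i j i<j (i Fin.≟ k) (j Fin.≟ k)
        ; w-mono     = λ i j i<j → w-mono′ i j i<j (i Fin.≟ k) (j Fin.≟ k)
        }
        where
        s′ : State
        s′ = u′ , y′
        a′ : Fin n → State
        a′ = a [ k ]≔ˢ s′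
        at : a′ k ≡ s′
        at = updateAt-updates k a
        off : ∀ {i} → i ≢ k → a′ i ≡ a i
        off i≢k = updateAt-minimal _ k a i≢k
        before : ∀ i → proj₁ (a′ i) ℕ.≤ m ℕ.+ proj₂ (a′ i)
        before i with i Fin.≟ k
        ... | yes ≡.refl = ≡.subst (λ s → proj₁ s ℕ.≤ m ℕ.+ proj₂ s) (≡.sym at)
          (ℕ.+-cancelʳ-≤ (proj₂ (a k)) _ _ (ℕ.≤-trans w′≤1+w
            (≡.subst (suc (proj₁ (a k) ℕ.+ y′) ℕ.≤_) (eq m (proj₂ (a k)) y′) (ℕ.+-monoˡ-≤ y′ u<m+y))))
          where
          eq : ∀ x y z → x ℕ.+ y ℕ.+ z ≡ x ℕ.+ z ℕ.+ y
          eq x y z = ≡.trans (ℕ.+-assoc x y z) (≡.trans (≡.cong (x ℕ.+_) (ℕ.+-comm y z)) (≡.sym (ℕ.+-assoc x z y)))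
        ... | no i≢k = ≡.subst (λ s → proj₁ s ℕ.≤ m ℕ.+ proj₂ s) (≡.sym (off i≢k)) (before-end i)
        u-mono′ : ∀ i j → toℕ i ℕ.< toℕ j → Dec (i ≡ k) → Dec (j ≡ k) → proj₁ (a′ i) ℕ.≤ proj₁ (a′ j)
        u-mono′ i j i<j (yes ≡.refl) (yes ≡.refl) = contradiction i<j (ℕ.<-irrefl ≡.refl)
        u-mono′ i j i<j (yes ≡.refl) (no j≢k) = ≡.subst₂ (λ s t → proj₁ s ℕ.≤ proj₁ t) (≡.sym at) (≡.sym (off j≢k))
          (ℕ.≤-trans u′≤1+u (higher j i<j))
        u-mono′ i j i<j (no i≢k) (yes ≡.refl) = ≡.subst₂ (λ s t → proj₁ s ℕ.≤ proj₁ t) (≡.sym (off i≢k)) (≡.sym at)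
          (ℕ.≤-trans (u-mono i k i<j) u≤u′)
        u-mono′ i j i<j (no i≢k) (no j≢k) = ≡.subst₂ (λ s t → proj₁ s ℕ.≤ proj₁ t) (≡.sym (off i≢k)) (≡.sym (off j≢k)) (u-mono i j i<j)
        w-mono′ : ∀ i j → toℕ i ℕ.< toℕ j → Dec (i ≡ k) → Dec (j ≡ k) → a′ j ≤ʷ a′ i
        w-mono′ i j i<j (yes ≡.refl) (yes ≡.refl) = contradiction i<j (ℕ.<-irrefl ≡.refl)
        w-mono′ i j i<j (yes ≡.refl) (no j≢k) = ≡.subst₂ _≤ʷ_ (≡.sym (off j≢k)) (≡.sym at)
          (≤ʷ-trans (a j) (a k) s′ (w-mono k j i<j) w≤w′)
        w-mono′ i j i<j (no i≢k) (yes ≡.refl) = ≡.subst₂ _≤ʷ_ (≡.sym at) (≡.sym (off i≢k)) (below (lower i i<j))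
          where
          open ℕ-Solver.+-*-Solver renaming (solve to solveℕ; _:+_ to _:+′_; _:=_ to _:=′_)
          below : a k <ʷ a i → s′ ≤ʷ a i
          below k<i = ℕ.+-cancelˡ-≤ (proj₂ (a k) ℕ.+ suc (proj₁ (a k))) _ _ (≡.subst₂ ℕ._≤_
            (solveℕ 4 (λ p q r t → p :+′ q :+′ (r :+′ t) :=′ q :+′ r :+′ (p :+′ t)) ≡.refl u′ (proj₂ (a k)) (suc (proj₁ (a k))) (proj₂ (a i)))
            (solveℕ 4 (λ r s p q → r :+′ s :+′ (p :+′ q) :=′ q :+′ r :+′ (p :+′ s)) ≡.refl (suc (proj₁ (a k))) y′ (proj₁ (a i)) (proj₂ (a k)))
            (ℕ.+-mono-≤ w′≤1+w k<i))
        w-mono′ i j i<j (no i≢k) (no j≢k) = ≡.subst₂ _≤ʷ_ (≡.sym (off j≢k)) (≡.sym (off i≢k)) (w-mono i j i<j)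

      separated : ∀ {u y} → a k ≡ (u , y) → ∀ i → i ≢ k → u ℕ.< proj₁ (a i) ⊎ u ℕ.+ proj₂ (a i) ℕ.< proj₁ (a i) ℕ.+ y
      separated ≡.refl i i≢k with ℕ.<-cmp (toℕ i) (toℕ k)
      ... | tri< i<k _ _ = inj₂ (lower i i<k)
      ... | tri≈ _ i≡k _ = contradiction (Fin.toℕ-injective i≡k) i≢k
      ... | tri> _ _ k<i = inj₁ (higher i k<i)

      module _ (u<m+n : proj₁ (a k) ℕ.< m ℕ.+ n)
               (hypothesis : ∀ s → Ordered (a [ k ]≔ˢ s) → remaining s ℕ.< remaining (a k) →
                             formAt (a [ k ]≔ˢ s) ≈ factor * N (a [ k ]≔ˢ s)) where

        private
          ∸-decreases : ∀ {x u} → u ℕ.< x → x ∸ suc u ℕ.< x ∸ u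
          ∸-decreases u<x = ℕ.∸-monoʳ-< (ℕ.n<1+n _) u<x

          up-ih : ∀ u y → a k ≡ (u , y) → formAt (a [ k ]≔ˢ (suc u , suc y)) ≈ factor * N (a [ k ]≔ˢ (suc u , suc y))
          up-ih u y ≡.refl = hypothesis (suc u , suc y)
            (ordered-step (suc u) (suc y) (ℕ.n≤1+n u) ℕ.≤-refl (ℕ.≤-reflexive (ℕ.+-suc u y))
              (s≤s (ℕ.+-monoʳ-≤ u (ℕ.n≤1+n y))))
            (ℕ.+-mono-<-≤ (∸-decreases u<m+n) (ℕ.≤-reflexive (≡.cong (_∸ suc u) (ℕ.+-suc m y))))

          level-ih : ∀ u y → a k ≡ (u , y) → formAt (a [ k ]≔ˢ (suc u , y)) ≈ factor * N (a [ k ]≔ˢ (suc u , y))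
          level-ih u y ≡.refl = hypothesis (suc u , y)
            (ordered-step (suc u) y (ℕ.n≤1+n u) ℕ.≤-refl (ℕ.n≤1+n _) ℕ.≤-refl)
            (ℕ.+-mono-< (∸-decreases u<m+n) (∸-decreases u<m+y))

          down-ih : ∀ u y → a k ≡ (u , suc y) → formAt (a [ k ]≔ˢ (u , y)) ≈ factor * N (a [ k ]≔ˢ (u , y))
          down-ih u y ak = hypothesis (u , y)
            (ordered-step u y (from ak (λ s → proj₁ s ℕ.≤ u) ℕ.≤-refl) (from ak (λ s → u ℕ.≤ suc (proj₁ s)) (ℕ.n≤1+n u))
              (from ak (_≤ʷ (u , y)) (ℕ.+-monoʳ-≤ u (ℕ.n≤1+n y)))
              (from ak (λ s → u ℕ.+ proj₂ s ℕ.≤ suc (proj₁ s ℕ.+ y)) (ℕ.≤-reflexive (ℕ.+-suc u y))))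
            (from ak (λ s → remaining (u , y) ℕ.< remaining s)
              (ℕ.+-monoʳ-< (m ℕ.+ n ∸ u) (ℕ.∸-monoˡ-< (ℕ.+-monoʳ-< m (ℕ.n<1+n y))
                (ℕ.≤-pred (≡.subst (u ℕ.<_) (ℕ.+-suc m y) (≡.subst (λ s → proj₁ s ℕ.< m ℕ.+ proj₂ s) ak u<m+y))))))
            where
            from : ∀ {s t : State} → s ≡ t → (P : State → Set) → P t → P s
            from eq P = ≡.subst P (≡.sym eq)

        step : ∀ u y → a k ≡ (u , y) → formAt a ≈ factor * N a
        step u zero ak = begin
          formAt a
            ≈⟨ formAt-step-0 a k u ak (≡.subst (u ℕ.<_) (ℕ.+-identityʳ m) u<) ⟩
          formAt (a [ k ]≔ˢ (suc u , 1)) + c 0 * formAt (a [ k ]≔ˢ (suc u , 0))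
            ≈⟨ +-cong (up-ih u 0 ak) (*-congˡ (level-ih u 0 ak)) ⟩
          factor * N (a [ k ]≔ˢ (suc u , 1)) + c 0 * (factor * N (a [ k ]≔ˢ (suc u , 0)))
            ≈⟨ solve 4 (λ x p c q → x :* p :+ c :* (x :* q) := x :* (p :+ c :* q)) refl _ _ _ _ ⟩
          factor * (N (a [ k ]≔ˢ (suc u , 1)) + c 0 * N (a [ k ]≔ˢ (suc u , 0)))
            ≈⟨ *-congˡ (N-step-0 a k u 0 ak u< (separated ak) ≡.refl) ⟨
          factor * N a ∎
          where
          u< : u ℕ.< m ℕ.+ 0
          u< = ≡.subst (λ s → proj₁ s ℕ.< m ℕ.+ proj₂ s) ak u<m+y
        step u (suc y) ak = begin
          formAt a
            ≈⟨ formAt-step-suc a k u y ak ⟩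
          formAt (a [ k ]≔ˢ (suc u , suc (suc y))) + (b (suc y) * formAt (a [ k ]≔ˢ (u , y)) + c (suc y) * formAt (a [ k ]≔ˢ (suc u , suc y)))
            ≈⟨ +-cong (up-ih u (suc y) ak) (+-cong (*-congˡ (down-ih u y ak)) (*-congˡ (level-ih u (suc y) ak))) ⟩
          factor * N (a [ k ]≔ˢ (suc u , suc (suc y))) + (b (suc y) * (factor * N (a [ k ]≔ˢ (u , y))) + c (suc y) * (factor * N (a [ k ]≔ˢ (suc u , suc y))))
            ≈⟨ solve 6 (λ x p b r c q → x :* p :+ (b :* (x :* r) :+ c :* (x :* q)) := x :* (p :+ (b :* r :+ c :* q))) refl _ _ _ _ _ _ ⟩
          factor * (N (a [ k ]≔ˢ (suc u , suc (suc y))) + (b (suc y) * N (a [ k ]≔ˢ (u , y)) + c (suc y) * N (a [ k ]≔ˢ (suc u , suc y))))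
            ≈⟨ *-congˡ (N-step-suc a k u (suc y) ak u< (separated ak) y ≡.refl) ⟨
          factor * N a ∎
          where
          u< : u ℕ.< m ℕ.+ suc y
          u< = ≡.subst (λ s → proj₁ s ℕ.< m ℕ.+ proj₂ s) ak u<m+y

    -- The fuel bounds the total of `remaining`. Starting points with `u ≥ m + n` are split off
    -- since no end point can be reached from them; in the remaining cases an up step strictly
    -- lowers the measure.
    formAt≈N : ∀ fuel a → Ordered a → total remaining a ℕ.< fuel → formAt a ≈ factor * N a
    formAt≈N (suc fuel) a ord (s≤s ≤fuel) = cases
      (Fin.any? λ i → Fin.any? λ j → ¬? (i Fin.≟ j) ×-dec ≡-dec ℕ._≟_ ℕ._≟_ (a i) (a j))
      (Fin.any? λ k → m ℕ.+ n ℕ.≤? proj₁ (a k))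
      (Fin.all? λ k → proj₁ (a k) ℕ.≟ m ℕ.+ proj₂ (a k))
      where
      cases : Dec (Collision a) → Dec (∃ λ k → m ℕ.+ n ℕ.≤ proj₁ (a k)) →
              Dec (∀ k → proj₁ (a k) ≡ m ℕ.+ proj₂ (a k)) → formAt a ≈ factor * N a
      cases (yes (i , j , i≢j , ai≡aj)) _ _ = both-zero a
        (alternating i j (column ∘ a) i≢j λ l → reflexive (≡.cong (λ s → column s l) ai≡aj))
        (N-collision a i j i≢j ai≡aj)
      cases (no _) (yes (k , m+n≤u)) _ = both-zero a
        (form-zero k (column ∘ a) λ j → γ-zero (proj₂ (a k)) (ℕ.<-≤-trans (ℕ.+-monoʳ-< m (Fin.toℕ<n j)) m+n≤u))
        (N-beyond a k (ℕ.<-≤-trans (ℕ.+-monoʳ-< m (Fin.toℕ<n k)) m+n≤u))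
      cases (no distinct) (no _) (yes finished) = all-finished a ord distinct finished
      cases (no distinct) (no inside) (no unfinished) = step a ord nxt
        (ℕ.≰⇒> λ m+n≤u → inside (Next.k nxt , m+n≤u))
        (λ s ord′ smaller → formAt≈N fuel _ ord′ (ℕ.<-≤-trans (total-updateAt-< remaining a (Next.k nxt) s smaller) ≤fuel))
        _ _ ≡.refl
        where
        nxt : Next a
        nxt = next a ord distinct unfinished

    initial : Fin n → State
    initial k = 0 , toℕ k

    formAt-initial : formAt initial ≈ factor * N initial
    formAt-initial = formAt≈N _ initial (record
      { before-end = λ _ → z≤n
      ; u-mono     = λ _ _ _ → z≤n
      ; w-mono     = λ _ _ → ℕ.<⇒≤
      }) (ℕ.n<1+n _)

    hankel : form (λ k j → g (m ℕ.+ toℕ k ℕ.+ toℕ j) 0) ≈ factor * N initial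
    hankel = trans (Triangular.hankel-columns D m) formAt-initial

  -- The sum over `S` as a sum over admissible tuples

  module _ (b c : ℕ → Carrier) (m n : ℕ) where
    open Paths b c m n

    private
      start-eq : ∀ k → pt (0 , k) ≡ (ℤ.- + k , + k)
      start-eq k = ≡.cong (_, + k) (ℤ.+-identityˡ _)

      end-eq : ∀ (k : Fin n) → endPoint m k ≡ (+ (2 ℕ.* m ℕ.+ toℕ k) , + toℕ k)
      end-eq k = ≡.cong (_, + toℕ k) (eq (+ m) (+ toℕ k))
        where
        eq : ∀ m k → (m ℤ.+ k) ℤ.+ (m ℤ.+ k) ℤ.- k ≡ m ℤ.+ (m ℤ.+ 0ℤ) ℤ.+ k
        eq = solve-∀

      words-eq : ∀ (k : Fin n) → proj₁ (endPoint m k) ℤ.- proj₁ (pt (0 , toℕ k)) ≡ + (2 ℕ.* m ℕ.+ toℕ k ℕ.+ toℕ k)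
      words-eq k = eq (+ m) (+ toℕ k)
        where
        eq : ∀ m k → (m ℤ.+ k) ℤ.+ (m ℤ.+ k) ℤ.- k ℤ.- (0ℤ ℤ.- k) ≡ m ℤ.+ (m ℤ.+ 0ℤ) ℤ.+ k ℤ.+ k
        eq = solve-∀

      candidates-eq : ∀ k → List.map (path (ℤ.- + toℕ k , + toℕ k)) (wordsOfWidth (2 ℕ.* m ℕ.+ toℕ k ℕ.+ toℕ k)) ≡
                            candidates (λ k → 0 , toℕ k) k
      candidates-eq k = ≡.cong₂ (λ p l → List.map (path p) (wordsᶻ l)) (≡.sym (start-eq (toℕ k))) (≡.sym (words-eq k))

    -- Both sums run over the same candidates, and each candidate has the prescribed starting point
    -- by construction, so the two tests agree on them.
    ∑S≈N : ∑S m n (tupleWeight b c) ≈ N (λ k → 0 , toℕ k)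
    ∑S≈N = begin
      ∑S m n (tupleWeight b c)
        ≈⟨ ∑ᴸ-filter (S? m n) (choices _) (tupleWeight b c) ⟩
      ∑ᶜ _ (λ v → restrict (S? m n v) (tupleWeight b c v))
        ≡⟨ ≡.cong (λ vs → ∑ᴸ vs (λ v → restrict (S? m n v) (tupleWeight b c v))) (choices-cong candidates-eq) ⟩
      ∑ᶜ (candidates (λ k → 0 , toℕ k)) (λ v → restrict (S? m n v) (tupleWeight b c v))
        ≈⟨ ∑ᶜ-cong (candidates (λ k → 0 , toℕ k)) (λ v v∈ → trans
             (restrict-scale (S? m n v) (admissible? m n (lookup v)) to (from v v∈) (sym (*-identityˡ _)))
             (*-identityˡ _)) ⟩
      N (λ k → 0 , toℕ k) ∎
      where
      to : ∀ {v} → S m n v → Admissible m n (lookup v)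
      to s = admissible (S.schröder s) (λ k → ≡.trans (S.ends s k) (≡.sym (end-eq k))) (S.nonIntersecting s)
      from : ∀ v → (∀ k → lookup v k ∈ candidates (λ k → 0 , toℕ k) k) → Admissible m n (lookup v) → S m n v
      from v v∈ (admissible s e d) = mkS s starts (λ k → ≡.trans (e k) (end-eq k)) d
        where
        starts : ∀ k → start (lookup v k) ≡ (ℤ.- + toℕ k , + toℕ k)
        starts k with ts , eq ← ∈-candidates (λ k → 0 , toℕ k) k (v∈ k) = ≡.trans (≡.cong start eq) (start-eq (toℕ k))

  -- The constant factors

  module _ (b : ℕ → Carrier) where

    private
      g₀ : ℕ → Carrier
      g₀ n = product {n} (λ i → b (suc (toℕ i)))

      snoc : ∀ (f : ℕ → Carrier) n → product {suc n} (f ∘ toℕ) ≈ product {n} (f ∘ toℕ) * f n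
      snoc f n = trans (Product.sum-init-last {n} (f ∘ toℕ)) (*-cong
        (Product.sum-cong-≋ {n} λ i → reflexive (≡.cong f (Fin.toℕ-inject₁ i)))
        (reflexive (≡.cong f (Fin.toℕ-fromℕ n))))

    g-0 : ∀ c y → Schröder.g b c 0 y ≈ product {y} (λ i → b (suc (toℕ i)))
    g-0 c zero    = refl
    g-0 c (suc y) = trans (*-congˡ (g-0 c y)) (trans (*-comm _ _) (sym (snoc (b ∘ suc) y)))

    -- The additional last factor has exponent zero; including it removes the truncated `n ∸ 1` from
    -- the range.
    ∏b^-full : ∀ n → ∏b^ b n ≈ product {n} (λ i → b (suc (toℕ i)) ^ (n ∸ suc (toℕ i)))
    ∏b^-full zero    = refl
    ∏b^-full (suc n) = sym (begin
      product {suc n} (λ i → b (suc (toℕ i)) ^ (n ∸ toℕ i))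
        ≈⟨ snoc (λ i → b (suc i) ^ (n ∸ i)) n ⟩
      ∏b^ b (suc n) * b (suc n) ^ (n ∸ n)
        ≈⟨ *-congˡ (^-congʳ (b (suc n)) (ℕ.n∸n≡0 n)) ⟩
      ∏b^ b (suc n) * 1#
        ≈⟨ *-identityʳ _ ⟩
      ∏b^ b (suc n) ∎)

    -- Passing from `n` to `n + 1` multiplies by `b 1` up to `b n`, which raises every exponent by
    -- one.
    product-g-0 : ∀ c n → product {n} (λ j → Schröder.g b c 0 (toℕ j)) ≈ ∏b^ b n
    product-g-0 c zero    = refl
    product-g-0 c (suc n) = begin
      product {suc n} (λ j → Schröder.g b c 0 (toℕ j))
        ≈⟨ snoc (Schröder.g b c 0) n ⟩
      product {n} (λ j → Schröder.g b c 0 (toℕ j)) * Schröder.g b c 0 n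
        ≈⟨ *-cong (trans (product-g-0 c n) (∏b^-full n)) (g-0 c n) ⟩
      product {n} (λ i → b (suc (toℕ i)) ^ (n ∸ suc (toℕ i))) * product {n} (λ i → b (suc (toℕ i)))
        ≈⟨ *-comm _ _ ⟩
      product {n} (λ i → b (suc (toℕ i))) * product {n} (λ i → b (suc (toℕ i)) ^ (n ∸ suc (toℕ i)))
        ≈⟨ Product.∑-distrib-+ {n} (λ i → b (suc (toℕ i))) (λ i → b (suc (toℕ i)) ^ (n ∸ suc (toℕ i))) ⟨
      product {n} (λ i → b (suc (toℕ i)) ^ suc (n ∸ suc (toℕ i)))
        ≈⟨ Product.sum-cong-≋ {n} (λ i → ^-congʳ (b (suc (toℕ i))) (≡.sym (ℕ.+-∸-assoc 1 (Fin.toℕ<n i)))) ⟩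
      ∏b^ b (suc n) ∎

  -- The exponents of the successive signs add up to the triangular number `0 + 1 + ... + (n - 1)`.
  reversalSign≈ : ∀ n → reversalSign n ≈ (- 1#) ^ (n ℕ.* (n ∸ 1) ℕ./ 2)
  reversalSign≈ zero    = refl
  reversalSign≈ (suc n) = begin
    (- 1#) ^ n * reversalSign n                      ≈⟨ *-congˡ (reversalSign≈ n) ⟩
    (- 1#) ^ n * (- 1#) ^ (n ℕ.* (n ∸ 1) ℕ./ 2)      ≈⟨ ^-homo-* (- 1#) n _ ⟨
    (- 1#) ^ (n ℕ.+ n ℕ.* (n ∸ 1) ℕ./ 2)             ≈⟨ ^-congʳ (- 1#) (≡.sym (triangle n)) ⟩
    (- 1#) ^ (suc n ℕ.* n ℕ./ 2)                     ∎
    where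
    expand : ∀ n → suc n ℕ.* n ≡ n ℕ.* 2 ℕ.+ n ℕ.* (n ∸ 1)
    expand zero    = ≡.refl
    expand (suc n) = solveℕ 1 (λ n → (conℕ 2 :+′ n) :*′ (conℕ 1 :+′ n) :=′ (conℕ 1 :+′ n) :*′ conℕ 2 :+′ (conℕ 1 :+′ n) :*′ n) ≡.refl n
      where open ℕ-Solver.+-*-Solver renaming (solve to solveℕ; con to conℕ; _:+_ to _:+′_; _:*_ to _:*′_; _:=_ to _:=′_)
    triangle : ∀ n → suc n ℕ.* n ℕ./ 2 ≡ n ℕ.+ n ℕ.* (n ∸ 1) ℕ./ 2
    triangle n = ≡.trans (≡.cong (ℕ._/ 2) (expand n)) (≡.trans
      (ℕ.+-distrib-/-∣ˡ {n ℕ.* 2} (n ℕ.* (n ∸ 1)) (ℕ.n∣m*n n))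
      (≡.cong (ℕ._+ n ℕ.* (n ∸ 1) ℕ./ 2) (ℕ.m*n/n≡m n 2)))

  hankel-∑S : ∀ b c m {n} (D : AlternatingForm n) →
    AlternatingForm.form D (λ k j → Schröder.g b c (m ℕ.+ toℕ k ℕ.+ toℕ j) 0) ≈
    (- 1#) ^ (n ℕ.* (n ∸ 1) ℕ./ 2) * ∏b^ b n * ∑S m n (tupleWeight b c)
  hankel-∑S b c m {n} D = trans (LGV.hankel b c m D)
    (*-cong (*-cong (reversalSign≈ n) (product-g-0 b c n)) (sym (∑S≈N b c m n)))

  -- Moments

  module Moments (b c : ℕ → Carrier) (κ : Carrier) (F : MomentFunctional b c κ) where
    open MomentFunctional F
    private
      module 𝓕 = ModuleMorphism.LeftModuleMorphisms.IsLeftModuleHomomorphism linear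

    -- eval p e is 𝓕[p(z) z^e], computed term by term.
    eval : Laurent → ℤ → Carrier
    eval []            e = 0#
    eval ((x , d) ∷ p) e = x * f (d ℤ.+ e) + eval p e

    𝓕-∷ : ∀ x d p → 𝓕 ((x , d) ∷ p) ≈ x * f d + 𝓕 p
    𝓕-∷ x d p = begin
      𝓕 ((x , d) ∷ p)                 ≈⟨ 𝓕.⟦⟧-cong (λ k → +-congʳ (same k)) ⟩
      𝓕 ((x ·ᴸ (z^ d)) ++ p)          ≈⟨ 𝓕.+ᴹ-homo (x ·ᴸ (z^ d)) p ⟩
      𝓕 (x ·ᴸ (z^ d)) + 𝓕 p           ≈⟨ +-congʳ (𝓕.*ₗ-homo x (z^ d)) ⟩
      x * f d + 𝓕 p                   ∎
      where
      same : ∀ k → (if does (d ℤ.≟ k) then x else 0#) ≈ (if does (d ℤ.≟ k) then x * 1# else 0#)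
      same k with d ℤ.≟ k
      ... | yes _ = sym (*-identityʳ x)
      ... | no  _ = refl

    𝓕-z^ : ∀ p e → 𝓕 (p *ᴸ z^ e) ≈ eval p e
    𝓕-z^ []            e = 𝓕.0ᴹ-homo
    𝓕-z^ ((x , d) ∷ p) e = trans (𝓕-∷ (x * 1#) (d ℤ.+ e) (p *ᴸ z^ e)) (+-cong (*-congʳ (*-identityʳ x)) (𝓕-z^ p e))

    eval-++ : ∀ p q e → eval (p ++ q) e ≈ eval p e + eval q e
    eval-++ []            q e = sym (+-identityˡ _)
    eval-++ ((x , d) ∷ p) q e = trans (+-congˡ (eval-++ p q e)) (sym (+-assoc _ _ _))

    eval-neg : ∀ p e → eval (-ᴸ p) e ≈ - eval p e
    eval-neg []            e = sym -0#≈0#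
    eval-neg ((x , d) ∷ p) e = trans (+-cong (sym (-‿distribˡ-* x _)) (eval-neg p e)) (-‿+-comm _ _)

    eval-monomial : ∀ x d p e → eval (List.map (λ (y , d′) → x * y , d ℤ.+ d′) p) e ≈ x * eval p (d ℤ.+ e)
    eval-monomial x d []             e = sym (zeroʳ x)
    eval-monomial x d ((y , d′) ∷ p) e = begin
      x * y * f (d ℤ.+ d′ ℤ.+ e) + eval (List.map _ p) e
        ≈⟨ +-cong (*-congˡ (reflexive (≡.cong f (rotate d d′ e)))) (eval-monomial x d p e) ⟩
      x * y * f (d′ ℤ.+ (d ℤ.+ e)) + x * eval p (d ℤ.+ e)
        ≈⟨ solve 4 (λ x y m v → x :* y :* m :+ x :* v := x :* (y :* m :+ v)) refl _ _ _ _ ⟩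
      x * (y * f (d′ ℤ.+ (d ℤ.+ e)) + eval p (d ℤ.+ e)) ∎
      where
      rotate : ∀ d d′ e → d ℤ.+ d′ ℤ.+ e ≡ d′ ℤ.+ (d ℤ.+ e)
      rotate = solve-∀

    φ : ℕ → ℤ → Carrier
    φ n e = eval (LBP b c n) e

    φ-0 : ∀ e → φ 0 e ≈ f e
    φ-0 e = trans (+-identityʳ _) (trans (*-identityˡ _) (reflexive (≡.cong f (ℤ.+-identityˡ e))))

    φ-vanish : ∀ {n k} → k ℕ.< n → φ n (ℤ.- + k) ≈ 0#
    φ-vanish {n} {k} k<n = trans (sym (𝓕-z^ (LBP b c n) (ℤ.- + k)))
      (trans (orthogonal n k (ℕ.<⇒≤ k<n)) (trans (*-congˡ δ≈0) (zeroʳ _)))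
      where
      δ≈0 : δ n k ≈ 0#
      δ≈0 = reflexive (≡.cong (λ t → if t then 1# else 0#) (dec-false (n ℕ.≟ k) (ℕ.<⇒≢ k<n ∘ ≡.sym)))

    φ-step-0 : ∀ e → φ 1 e + c 0 * φ 0 e ≈ φ 0 (1ℤ ℤ.+ e)
    φ-step-0 e = begin
      1# * f (1ℤ ℤ.+ e) + (- c 0 * f (0ℤ ℤ.+ e) + 0#) + c 0 * (1# * f (0ℤ ℤ.+ e) + 0#)
        ≈⟨ solve 4 (λ u n c v → con 1 :* u :+ (n :* v :+ con 0) :+ c :* (con 1 :* v :+ con 0) := u :+ (n :+ c) :* v) refl
             (f (1ℤ ℤ.+ e)) (- c 0) (c 0) (f (0ℤ ℤ.+ e)) ⟩
      f (1ℤ ℤ.+ e) + (- c 0 + c 0) * f (0ℤ ℤ.+ e)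
        ≈⟨ +-congˡ (trans (*-congʳ (-‿inverseˡ (c 0))) (zeroˡ _)) ⟩
      f (1ℤ ℤ.+ e) + 0#
        ≈⟨ trans (+-identityʳ _) (sym (φ-0 _)) ⟩
      φ 0 (1ℤ ℤ.+ e) ∎

    φ-step-suc : ∀ n e → φ (suc (suc n)) e + c (suc n) * φ (suc n) e + b (suc n) * φ n (1ℤ ℤ.+ e) ≈ φ (suc n) (1ℤ ℤ.+ e)
    φ-step-suc n e = begin
      φ (suc (suc n)) e + c₁ * φ (suc n) e + b₁ * φ n (1ℤ ℤ.+ e)
        ≈⟨ +-congʳ (+-cong recurrence (*-congˡ (reflexive (≡.cong (φ (suc n)) (≡.sym (ℤ.+-identityˡ e)))))) ⟩
      u + - c₁ * v + - (b₁ * w) + c₁ * v + b₁ * w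
        -- The solver works over semirings, so negated terms enter as separate atoms and are
        -- cancelled afterwards.
        ≈⟨ solve 6 (λ u n c v q p → u :+ n :* v :+ q :+ c :* v :+ p := u :+ (n :+ c) :* v :+ (q :+ p)) refl
             u (- c₁) c₁ v (- (b₁ * w)) (b₁ * w) ⟩
      u + (- c₁ + c₁) * v + (- (b₁ * w) + b₁ * w)
        ≈⟨ +-cong (+-congˡ (trans (*-congʳ (-‿inverseˡ c₁)) (zeroˡ _))) (-‿inverseˡ _) ⟩
      u + 0# + 0#
        ≈⟨ trans (+-identityʳ _) (+-identityʳ _) ⟩
      u ∎
      where
      c₁ b₁ u v w : Carrier
      c₁ = c (suc n)
      b₁ = b (suc n)
      u  = φ (suc n) (1ℤ ℤ.+ e)
      v  = φ (suc n) (0ℤ ℤ.+ e)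
      w  = φ n (1ℤ ℤ.+ e)
      P Q : Laurent
      P = LBP b c (suc n)
      Q = LBP b c n
      shift : Carrier → ℤ → Laurent → Laurent
      shift x d p = List.map (λ (y , d′) → x * y , d ℤ.+ d′) p
      recurrence : φ (suc (suc n)) e ≈ u + - c₁ * v + - (b₁ * w)
      recurrence = begin
        eval ((z -ᴸ constant c₁) *ᴸ P -ᴸ b₁ ·ᴸ z *ᴸ Q) e
          ≈⟨ eval-++ ((z -ᴸ constant c₁) *ᴸ P) (-ᴸ (b₁ ·ᴸ z *ᴸ Q)) e ⟩
        eval ((z -ᴸ constant c₁) *ᴸ P) e + eval (-ᴸ (b₁ ·ᴸ z *ᴸ Q)) e
          ≈⟨ +-cong
               (trans (eval-++ (shift 1# 1ℤ P) _ e) (+-cong (trans (eval-monomial 1# 1ℤ P e) (*-identityˡ _))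
                 (trans (eval-++ (shift (- c₁) 0ℤ P) [] e) (trans (+-identityʳ _) (eval-monomial (- c₁) 0ℤ P e)))))
               (trans (eval-neg (b₁ ·ᴸ z *ᴸ Q) e) (-‿cong
                 (trans (eval-++ (shift (b₁ * 1#) 1ℤ Q) [] e) (trans (+-identityʳ _)
                   (trans (eval-monomial (b₁ * 1#) 1ℤ Q e) (*-congʳ (*-identityʳ b₁))))))) ⟩
        u + - c₁ * v + - (b₁ * w) ∎

    module _ where
      open Schröder b c

      -- The recurrence read as z P_n = P_{n+1} + c_n P_n + b_n z P_{n-1} is the
      -- first-step decomposition of Schröder paths.
      φ-positive : ∀ s y → φ y (+ suc s) ≈ κ * g s y
      φ-positive zero zero = trans (φ-0 1ℤ) (trans normalized (sym (*-identityʳ κ)))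
      -- In the recurrence at `e = 0` orthogonality removes the up and level terms; only the down
      -- step is left.
      φ-positive zero (suc y) = begin
        φ (suc y) 1ℤ
          ≈⟨ φ-step-suc y 0ℤ ⟨
        φ (suc (suc y)) 0ℤ + c (suc y) * φ (suc y) 0ℤ + b (suc y) * φ y 1ℤ
          ≈⟨ +-cong (+-cong (φ-vanish {suc (suc y)} {0} (s≤s z≤n)) (trans (*-congˡ (φ-vanish {suc y} {0} (s≤s z≤n))) (zeroʳ _))) (*-congˡ (φ-positive zero y)) ⟩
        0# + 0# + b (suc y) * (κ * g 0 y)
          ≈⟨ solve 3 (λ b κ x → con 0 :+ con 0 :+ b :* (κ :* x) := κ :* (b :* x)) refl _ _ _ ⟩
        κ * (b (suc y) * g 0 y) ∎
      φ-positive (suc s) zero = begin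
        φ 0 (+ suc (suc s))
          ≈⟨ φ-step-0 (+ suc s) ⟨
        φ 1 (+ suc s) + c 0 * φ 0 (+ suc s)
          ≈⟨ +-cong (φ-positive s 1) (*-congˡ (φ-positive s 0)) ⟩
        κ * g s 1 + c 0 * (κ * g s 0)
          ≈⟨ solve 4 (λ κ x c y → κ :* x :+ c :* (κ :* y) := κ :* (x :+ c :* y)) refl _ _ _ _ ⟩
        κ * g (suc s) 0 ∎
      φ-positive (suc s) (suc y) = begin
        φ (suc y) (+ suc (suc s))
          ≈⟨ φ-step-suc y (+ suc s) ⟨
        φ (suc (suc y)) (+ suc s) + c (suc y) * φ (suc y) (+ suc s) + b (suc y) * φ y (+ suc (suc s))
          ≈⟨ +-cong (+-cong (φ-positive s (suc (suc y))) (*-congˡ (φ-positive s (suc y)))) (*-congˡ (φ-positive (suc s) y)) ⟩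
        κ * g s (suc (suc y)) + c (suc y) * (κ * g s (suc y)) + b (suc y) * (κ * g (suc s) y)
          ≈⟨ solve 6 (λ κ x c y b v → κ :* x :+ c :* (κ :* y) :+ b :* (κ :* v) := κ :* (x :+ b :* v :+ c :* y)) refl _ _ _ _ _ _ ⟩
        κ * g (suc s) (suc y) ∎

    module Negative (c#0 : ∀ n → c n # 0#) where
      open Tilde b c c#0 κ
      open Schröder b̃ c̃

      -- P_y(0)
      C : ℕ → Carrier
      C zero    = 1#
      C (suc y) = - c y * C y

      c̃-inverse : ∀ y → c̃ y * c y ≈ 1#
      c̃-inverse y = inv-inverseˡ (c y) (c#0 y)

      c-cancel : ∀ y {X Y R} → c y * X + R ≈ c y * Y + R → X ≈ Y
      c-cancel y {X} {Y} {R} eq = begin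
        X                  ≈⟨ unit X ⟨
        c̃ y * (c y * X)    ≈⟨ *-congˡ (+-cancelʳ R _ _ eq) ⟩
        c̃ y * (c y * Y)    ≈⟨ unit Y ⟩
        Y                  ∎
        where
        unit : ∀ X → c̃ y * (c y * X) ≈ X
        unit X = trans (sym (*-assoc _ _ _)) (trans (*-congʳ (c̃-inverse y)) (*-identityˡ X))

      -- Solves p + c_y x + κ̃ t = q for x; here t comes from the b-term.
      solve-step : ∀ y {x p q G₀ G₁} t T → p + c y * x + κ̃ * t ≈ q →
                   p ≈ κ̃ * (C (suc y) * G₁) → q ≈ κ̃ * (C y * G₀) → c y * (C y * T) + t ≈ 0# →
                   x ≈ κ̃ * (C y * (G₁ + T + c̃ y * G₀))
      solve-step y {x} {p} {q} {G₀} {G₁} t T eq p≈ q≈ T≈ = c-cancel y (begin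
        c y * x + (p + κ̃ * t)
          ≈⟨ solve 3 (λ u p v → u :+ (p :+ v) := p :+ u :+ v) refl _ _ _ ⟩
        p + c y * x + κ̃ * t
          ≈⟨ trans eq q≈ ⟩
        κ̃ * (C y * G₀)
          -- The unit and the two zeros are placeholders, to be replaced by `c̃ y * c y`, by the
          -- left side of `T≈`, and by a multiple of `- c y + c y`.
          ≈⟨ solve 3 (λ κ C G → κ :* (C :* G) := κ :* (con 1 :* C :* G) :+ κ :* con 0 :+ κ :* (con 0 :* (C :* con 0))) refl _ _ _ ⟩
        κ̃ * (1# * C y * G₀) + κ̃ * 0# + κ̃ * (0# * (C y * 0#))
          ≈⟨ +-cong (+-cong (*-congˡ (*-congʳ (*-congʳ (c̃-inverse y)))) (*-congˡ T≈))
               (*-congˡ (trans (*-congʳ (-‿inverseˡ (c y))) (trans (zeroˡ _) (sym (zeroˡ _))))) ⟨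
        κ̃ * (c̃ y * c y * C y * G₀) + κ̃ * (c y * (C y * T) + t) + κ̃ * ((- c y + c y) * (C y * G₁))
          ≈⟨ solve 9 (λ κ c̃ c C G₀ T t n G₁ →
               κ :* (c̃ :* c :* C :* G₀) :+ κ :* (c :* (C :* T) :+ t) :+ κ :* ((n :+ c) :* (C :* G₁)) :=
               c :* (κ :* (C :* (G₁ :+ T :+ c̃ :* G₀))) :+ (κ :* (n :* C :* G₁) :+ κ :* t)) refl
               κ̃ (c̃ y) (c y) (C y) G₀ T t (- c y) G₁ ⟩
        c y * (κ̃ * (C y * (G₁ + T + c̃ y * G₀))) + (κ̃ * (C (suc y) * G₁) + κ̃ * t)
          ≈⟨ +-congˡ (+-congʳ p≈) ⟨
        c y * (κ̃ * (C y * (G₁ + T + c̃ y * G₀))) + (p + κ̃ * t) ∎)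

      -- The origin of the two denominators in `b̃`: one factor `c` comes from solving the
      -- recurrence for its `c`-term, the other from the ratio of consecutive values `C`, whose
      -- minus sign produces the cancellation.
      b-term : ∀ y G → c (suc y) * (C (suc y) * (b̃ (suc y) * G)) + b (suc y) * (C y * G) ≈ 0#
      b-term y G = begin
        c₁ * ((- c₀ * C y) * ((b₁ * v) * G)) + b₁ * (C y * G)
          ≈⟨ solve 6 (λ c₁ n C b v G → c₁ :* ((n :* C) :* ((b :* v) :* G)) :+ b :* (C :* G) :=
               (n :* (c₁ :* v) :+ con 1) :* (b :* (C :* G))) refl c₁ (- c₀) (C y) b₁ v G ⟩
        (- c₀ * (c₁ * v) + 1#) * (b₁ * (C y * G))
          ≈⟨ *-congʳ (trans (+-cong (sym (-‿distribˡ-* c₀ (c₁ * v))) (sym inverse)) (-‿inverseˡ _)) ⟩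
        0# * (b₁ * (C y * G))
          ≈⟨ zeroˡ _ ⟩
        0# ∎
        where
        c₀ c₁ b₁ v : Carrier
        c₀ = c y
        c₁ = c (suc y)
        b₁ = b (suc y)
        v  = inv (c y * c (suc y)) _
        inverse : c₀ * (c₁ * v) ≈ 1#
        inverse = trans (sym (*-assoc _ _ _)) (trans (*-comm _ _) (inv-inverseˡ (c y * c (suc y)) _))

      1-suc : ∀ k → 1ℤ ℤ.+ ℤ.- + suc k ≡ ℤ.- + k
      1-suc k = eq (+ k)
        where
        eq : ∀ k → 1ℤ ℤ.+ ℤ.- (1ℤ ℤ.+ k) ≡ ℤ.- k
        eq = solve-∀

      -- Orthogonality of `z - c 0` to the constants says that `c 0` times the moment `f 0` is `κ`,
      -- which explains the value of `κ̃`.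
      φ-00 : φ 0 0ℤ ≈ κ̃
      φ-00 = c-cancel 0 (+-congʳ {x = 0#} (begin
        c 0 * φ 0 0ℤ                ≈⟨ +-identityˡ _ ⟨
        0# + c 0 * φ 0 0ℤ           ≈⟨ +-congʳ (φ-vanish {1} {0} (s≤s z≤n)) ⟨
        φ 1 0ℤ + c 0 * φ 0 0ℤ       ≈⟨ φ-step-0 0ℤ ⟩
        φ 0 1ℤ                      ≈⟨ trans (φ-0 1ℤ) normalized ⟩
        κ                           ≈⟨ *-identityʳ κ ⟨
        κ * 1#                      ≈⟨ *-congˡ (c̃-inverse 0) ⟨
        κ * (c̃ 0 * c 0)             ≈⟨ solve 3 (λ κ v c → κ :* (v :* c) := c :* (κ :* v)) refl _ _ _ ⟩
        c 0 * κ̃                     ∎))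

      -- Up to the factor P_y(0), the functional sees P_y(z) z^{-(s+y)} as the
      -- polynomials with coefficients b̃, c̃ see the point (s , y).
      φ-negative : ∀ s y k → k ≡ s ℕ.+ y → φ y (ℤ.- + k) ≈ κ̃ * (C y * g s y)
      φ-negative zero zero k ≡.refl = trans φ-00 (solve 1 (λ κ → κ := κ :* (con 1 :* con 1)) refl κ̃)
      φ-negative zero (suc y) (suc k) ≡.refl = trans
        -- Both neighbouring values vanish by orthogonality, so the up and level contributions are
        -- zero and only the down step is left.
        (solve-step (suc y) {G₀ = 0#} {G₁ = 0#} (b (suc y) * (C y * g 0 y)) (b̃ (suc y) * g 0 y)
          (begin
            φ (suc (suc y)) (ℤ.- + suc y) + c (suc y) * φ (suc y) (ℤ.- + suc y) + κ̃ * (b (suc y) * (C y * g 0 y))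
              ≈⟨ +-congˡ (solve 4 (λ κ b C g → κ :* (b :* (C :* g)) := b :* (κ :* (C :* g))) refl _ _ _ _) ⟩
            φ (suc (suc y)) (ℤ.- + suc y) + c (suc y) * φ (suc y) (ℤ.- + suc y) + b (suc y) * (κ̃ * (C y * g 0 y))
              ≈⟨ +-congˡ (*-congˡ (trans (reflexive (≡.cong (φ y) (1-suc y))) (φ-negative zero y y ≡.refl))) ⟨
            φ (suc (suc y)) (ℤ.- + suc y) + c (suc y) * φ (suc y) (ℤ.- + suc y) + b (suc y) * φ y (1ℤ ℤ.+ ℤ.- + suc y)
              ≈⟨ φ-step-suc y (ℤ.- + suc y) ⟩
            φ (suc y) (1ℤ ℤ.+ ℤ.- + suc y) ∎)
          (trans (φ-vanish (ℕ.n<1+n (suc y))) (sym (trans (*-congˡ (zeroʳ _)) (zeroʳ _))))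
          (trans (reflexive (≡.cong (φ (suc y)) (1-suc y))) (trans (φ-vanish (ℕ.n<1+n y)) (sym (trans (*-congˡ (zeroʳ _)) (zeroʳ _)))))
          (b-term y (g 0 y)))
        (*-congˡ (*-congˡ (trans (+-cong (+-identityˡ _) (zeroʳ _)) (+-identityʳ _))))
      φ-negative (suc s) zero (suc k) eq = trans
        (solve-step 0 {G₀ = g s 0} {G₁ = g s 1} 0# 0#
          (trans (+-congˡ (zeroʳ _)) (trans (+-identityʳ _) (φ-step-0 (ℤ.- + suc k))))
          (φ-negative s 1 (suc k) (≡.trans eq (≡.sym (ℕ.+-suc s 0))))
          (trans (reflexive (≡.cong (φ 0) (1-suc k))) (φ-negative s 0 k (ℕ.suc-injective eq)))
          (trans (+-identityʳ _) (trans (*-congˡ (zeroʳ _)) (zeroʳ _))))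
        (*-congˡ (*-congˡ (+-congʳ (+-identityʳ _))))
      φ-negative (suc s) (suc y) (suc k) eq =
        solve-step (suc y) {G₀ = g s (suc y)} {G₁ = g s (suc (suc y))} (b (suc y) * (C y * g (suc s) y)) (b̃ (suc y) * g (suc s) y)
          (begin
            φ (suc (suc y)) e + c (suc y) * φ (suc y) e + κ̃ * (b (suc y) * (C y * g (suc s) y))
              ≈⟨ +-congˡ (solve 4 (λ κ b C g → κ :* (b :* (C :* g)) := b :* (κ :* (C :* g))) refl _ _ _ _) ⟩
            φ (suc (suc y)) e + c (suc y) * φ (suc y) e + b (suc y) * (κ̃ * (C y * g (suc s) y))
              ≈⟨ +-congˡ (*-congˡ (trans (reflexive (≡.cong (φ y) (1-suc k)))
                   (φ-negative (suc s) y k (≡.trans (ℕ.suc-injective eq) (ℕ.+-suc s y))))) ⟨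
            φ (suc (suc y)) e + c (suc y) * φ (suc y) e + b (suc y) * φ y (1ℤ ℤ.+ e)
              ≈⟨ φ-step-suc y e ⟩
            φ (suc y) (1ℤ ℤ.+ e) ∎)
          (φ-negative s (suc (suc y)) (suc k) (≡.trans eq (≡.sym (ℕ.+-suc s (suc y)))))
          (trans (reflexive (≡.cong (φ (suc y)) (1-suc k))) (φ-negative s (suc y) k (ℕ.suc-injective eq)))
          (b-term y (g (suc s) y))
        where
        e : ℤ
        e = ℤ.- + suc k

      moment-negative : ∀ s → f (ℤ.- + s) ≈ κ̃ * g s 0
      moment-negative s = trans (sym (φ-0 _)) (trans (φ-negative s 0 s (≡.sym (ℕ.+-identityʳ s))) (*-congˡ (*-identityˡ _)))

    moment-positive : ∀ s → f (+ suc s) ≈ κ * Schröder.g b c s 0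
    moment-positive s = trans (sym (φ-0 _)) (φ-positive s 0)

  -- The two determinant formulas

  module DeterminantFormula (b c : ℕ → Carrier) (κ : Carrier) (c#0 : ∀ n → c n # 0#) (F : MomentFunctional b c κ) where
    open MomentFunctional F using (f)
    open Tilde b c c#0 κ
    open Moments b c κ F
    open Negative c#0
    open AlternatingForm

    sign : ℕ → Carrier
    sign n = (- 1#) ^ (n ℕ.* (n ∸ 1) ℕ./ 2)

    scaled-hankel : ∀ x b c m {n} (D : AlternatingForm n) →
      x ^ n * form D (λ k j → Schröder.g b c (m ℕ.+ toℕ k ℕ.+ toℕ j) 0) ≈
      sign n * x ^ n * ∏b^ b n * ∑S m n (tupleWeight b c)
    scaled-hankel x b c m D = trans (*-congˡ (hankel-∑S b c m D))
      (solve 4 (λ x s p N → x :* (s :* p :* N) := s :* x :* p :* N) refl _ _ _ _)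

    -- Here `s - j + k = 1 + (m + k + (n - 1 - j))`; the 1 is the shift of index between moments and
    -- path counts, and `n - 1 - j` is the reversed row.
    Δ-positive : ∀ s m n → s ≡ + m ℤ.+ + n →
      Δ f s n ≈ sign n * κ ^ n * ∏b^ b n * ∑S m n (tupleWeight b c)
    Δ-positive s m n ≡.refl = begin
      Δ f s n
        ≈⟨ det-cong (λ j k → trans (reflexive (≡.cong f (index j k))) (moment-positive (m ℕ.+ toℕ k ℕ.+ toℕ (opposite j)))) ⟩
      det {n} (λ j k → κ * Schröder.g b c (m ℕ.+ toℕ k ℕ.+ toℕ (opposite j)) 0)
        ≈⟨ det-scale {n} κ _ ⟩
      κ ^ n * form (detReversedRows n) (λ k j → Schröder.g b c (m ℕ.+ toℕ k ℕ.+ toℕ j) 0)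
        ≈⟨ scaled-hankel κ b c m (detReversedRows n) ⟩
      sign n * κ ^ n * ∏b^ b n * ∑S m n (tupleWeight b c) ∎
      where
      index : ∀ (j k : Fin n) → + m ℤ.+ + n ℤ.- + toℕ j ℤ.+ + toℕ k ≡ + suc (m ℕ.+ toℕ k ℕ.+ toℕ (opposite j))
      index j k = ≡.trans (≡.cong (λ t → + m ℤ.+ t ℤ.- + toℕ j ℤ.+ + toℕ k) (opposite-sum j))
        (eq (+ m) (+ toℕ (opposite j)) (+ toℕ j) (+ toℕ k))
        where
        eq : ∀ m o j k → m ℤ.+ (o ℤ.+ (1ℤ ℤ.+ j)) ℤ.- j ℤ.+ k ≡ 1ℤ ℤ.+ (m ℤ.+ k ℤ.+ o)
        eq = solve-∀

    -- Here `s - j + k = - (m + (n - 1 - k) + j)`, with the column reversed and no shift of index.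
    -- The equation for `s` is used only to compare entries, hence its guard `Fin n`.
    Δ-negative : ∀ s m n → (Fin n → s ≡ 1ℤ ℤ.- (+ m ℤ.+ + n)) →
      Δ f s n ≈ sign n * κ̃ ^ n * ∏b^ b̃ n * ∑S m n (tupleWeight b̃ c̃)
    Δ-negative s m n s≡ = begin
      Δ f s n
        ≈⟨ det-cong (λ j k → trans (reflexive (≡.cong f (index j k))) (moment-negative (m ℕ.+ toℕ (opposite k) ℕ.+ toℕ j))) ⟩
      det {n} (λ j k → κ̃ * Schröder.g b̃ c̃ (m ℕ.+ toℕ (opposite k) ℕ.+ toℕ j) 0)
        ≈⟨ det-scale {n} κ̃ _ ⟩
      κ̃ ^ n * form (detReversedColumns n) (λ k j → Schröder.g b̃ c̃ (m ℕ.+ toℕ k ℕ.+ toℕ j) 0)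
        ≈⟨ scaled-hankel κ̃ b̃ c̃ m (detReversedColumns n) ⟩
      sign n * κ̃ ^ n * ∏b^ b̃ n * ∑S m n (tupleWeight b̃ c̃) ∎
      where
      index : ∀ (j k : Fin n) → s ℤ.- + toℕ j ℤ.+ + toℕ k ≡ ℤ.- + (m ℕ.+ toℕ (opposite k) ℕ.+ toℕ j)
      index j k = ≡.trans (≡.cong (λ t → t ℤ.- + toℕ j ℤ.+ + toℕ k)
          (≡.trans (s≡ j) (≡.cong (λ t → 1ℤ ℤ.- (+ m ℤ.+ t)) (opposite-sum k))))
        (eq (+ m) (+ toℕ (opposite k)) (+ toℕ j) (+ toℕ k))
        where
        eq : ∀ m o j k → 1ℤ ℤ.- (m ℤ.+ (o ℤ.+ (1ℤ ℤ.+ k))) ℤ.- j ℤ.+ k ≡ ℤ.- (m ℤ.+ o ℤ.+ j)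
        eq = solve-∀

theorem6 :
  ∀ {a ℓ₁ ℓ₂} (K : HeytingField a ℓ₁ ℓ₂) →
  let open HeytingField K
      open Over K in
  (b c : ℕ → Carrier) (κ : Carrier) →
  (b#0 : ∀ n → 1 ℕ.≤ n → b n # 0#) →
  (c#0 : ∀ n → c n # 0#) →
  (κ#0 : κ # 0#) →
  (F : MomentFunctional b c κ) →
  let open MomentFunctional F using (f)
      open Tilde b c c#0 κ in
  (s : ℤ) (n : ℕ) →
  (+ n ℤ.≤ s →
    Δ f s n ≈ (- 1#) ^ (n ℕ.* (n ∸ 1) ℕ./ 2) * κ ^ n * ∏b^ b n
              * ∑S ∣ s ℤ.- + n ∣ n (tupleWeight b c))
  ×
  (s ℤ.≤ ℤ.- + n ℤ.+ 1ℤ →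
    Δ f s n ≈ (- 1#) ^ (n ℕ.* (n ∸ 1) ℕ./ 2) * κ̃ ^ n * ∏b^ b̃ n
              * ∑S (suc ∣ s ∣ ∸ n) n (tupleWeight b̃ c̃))
theorem6 K b c κ b#0 c#0 κ#0 F s n =
  (λ n≤s → Δ-positive s ∣ s ℤ.- + n ∣ n (∣-∣-offset n≤s)) ,
  (λ s≤ → Δ-negative s (suc ∣ s ∣ ∸ n) n (negative-offset s≤))
  where open DeterminantFormula K b c κ c#0 F
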